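{- Every threshold dot-depth one language belongs to $\mathcal{P}(\mathbf{J})$.
   Context: $\mathbb{N}$ includes $0$; $[n] = \{1, \ldots, n\}$; all alphabets are finite. Threshold dot-depth one languages. A word $u$ is a subword of $w$ if it is a (not necessarily contiguous) subsequence of $w$; it is a factor of $w$ if $w = xuy$ for some words $x, y$. Let $\Sigma$ be an alphabet. For $u \in \Sigma^*$, let $\mathrm{Sub}(u) \subseteq \Sigma^*$ be the language of all words over $\Sigma$ having $u$ as a subword. For $u \in \Sigma^+$ and $l \in \mathbb{N}_{>0}$, let $[u]_l = \Sigma^* u \Sigma^* \cup \mathrm{Sub}(u^l)$. For $k \geq 2$ and $u_1, \ldots, u_k \in \Sigma^+$, let $[u_1, \ldots, u_k]_l = [u_1]_l [u_2]_l \cdots [u_k]_l$ (concatenation of languages). A threshold dot-depth one language over $\Sigma$ is any Boolean combination of languages over $\Sigma$ of the form $\Sigma^* u$, $u \Sigma^*$ and $[u_1, \ldots, u_k]_l$, for $k, l \in \mathbb{N}_{>0}$ and $u, u_1, \ldots, u_k \in \Sigma^+$. The class $\mathcal{P}(\mathbf{J})$. The idempotent power of a finite monoid $M$ is the smallest $\omega \in \mathbb{N}_{>0}$ with $x^\omega = x^{2\omega}$ for all $x \in M$. $\mathbf{J}$ is the class of finite monoids $M$, of idempotent power $\omega$, such that $(xy)^\omega = (xy)^\omega x = y (xy)^\omega$ for all $x, y \in M$. A program $P$ over a finite monoid $M$ on $\Sigma^n$ is a finite sequence of instructions $(i, f)$ with $i \in [n]$ and $f \colon \Sigma \to M$; its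 length $|P|$ is its number of instructions. On input $w \in \Sigma^n$, instruction $(i, f)$ outputs $f(w_i)$, and $P(w) \in M$ is the product, in order, of these outputs. $P$ recognises $L \subseteq \Sigma^n$ if $L = P^{ -1}(F)$ for some $F \subseteq M$. $\mathcal{P}(\mathbf{J})$ is the class of languages $L \subseteq \Sigma^*$ ($\Sigma$ any alphabet) for which there exist a monoid $M \in \mathbf{J}$, a real $\alpha > 0$, an integer $j \in \mathbb{N}$ and programs $P_n$ over $M$ on $\Sigma^n$ ($n \in \mathbb{N}$) such that $P_n$ recognises $L \cap \Sigma^n$ and $|P_n| \leq \alpha \cdot n^j$ for all $n \in \mathbb{N}$. -}

module Defs where

open import Algebra.Bundles using (Monoid)
import Algebra.Definitions.RawMonoid as RawMonoidDefinitions
open import Data.Fin.Base using (Fin)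
open import Data.List.Base as List using (List; []; _∷_; _++_)
open import Data.List.NonEmpty.Base as List⁺ using (List⁺)
open import Data.List.Relation.Binary.Sublist.Propositional using () renaming (_⊆_ to _IsSubwordOf_)
open import Data.Nat.Base as ℕ using (ℕ; _≤_; _<_)
open import Data.Product.Base using (∃; ∃-syntax; Σ-syntax; _×_; _,_)
open import Data.Vec.Base as Vec using (Vec)
open import Function.Bundles using (Inverse; _⇔_)
open import Level using (0ℓ)
open import Relation.Binary.Bundles using (Setoid)
open import Relation.Binary.Definitions using (_Respects_)
open import Relation.Binary.PropositionalEquality.Core using (_≡_)
import Relation.Binary.PropositionalEquality.Properties as ≡
open import Relation.Unary using (Pred; U; ∅; ∁; _∩_; _∪_; _≐_; ｛_｝)

FiniteSetoid : Setoid 0ℓ 0ℓ → Set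
FiniteSetoid S = ∃[ n ] Inverse (≡.setoid (Fin n)) S

Finite : Set → Set
Finite A = FiniteSetoid (≡.setoid A)

Language : Set → Set₁
Language A = Pred (List A) 0ℓ

module _ {A : Set} where

  infixr 7 _·_

  _·_ : Language A → Language A → Language A
  (K · L) w = ∃[ x ] ∃[ y ] (w ≡ x ++ y × K x × L y)

  _^ʷ_ : List A → ℕ → List A
  u ^ʷ l = List.concat (List.replicate l u)

  Sub : List A → Language A
  Sub u w = u IsSubwordOf w

  -- Below, U is the language of all words and ｛ u ｝ the language whose
  -- only word is u; a non-empty word is an element of List⁺ A.

  [_]₁ : List⁺ A → ℕ → Language A
  [ u ]₁ l = (U · ｛ List⁺.toList u ｝ · U) ∪ Sub (List⁺.toList u ^ʷ l)

  -- The list u₁ , … , uₖ is non-empty, and for k = 1 this is [ u₁ ]₁ l.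
  [_]⁺ : List⁺ (List⁺ A) → ℕ → Language A
  [ us ]⁺ l = List⁺.foldr₁ _·_ (List⁺.map (λ u → [ u ]₁ l) us)

  data Generator : Language A → Set₁ where
    endsWith   : (u : List⁺ A) → Generator (U · ｛ List⁺.toList u ｝)
    startsWith : (u : List⁺ A) → Generator (｛ List⁺.toList u ｝ · U)
    block      : (us : List⁺ (List⁺ A)) (l : ℕ) → 0 < l → Generator ([ us ]⁺ l)

  -- Languages are predicates, so being the same language is
  -- extensional equality _≐_. The constructor none is the empty
  -- Boolean combination; it is redundant as soon as 𝒢 is inhabited.
  data BooleanCombination (𝒢 : Language A → Set₁) : Language A → Set₁ where
    generator    : ∀ {L} → 𝒢 L → BooleanCombination 𝒢 L
    none         : BooleanCombination 𝒢 ∅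
    complement   : ∀ {L} → BooleanCombination 𝒢 L → BooleanCombination 𝒢 (∁ L)
    union        : ∀ {K L} → BooleanCombination 𝒢 K → BooleanCombination 𝒢 L →
                   BooleanCombination 𝒢 (K ∪ L)
    intersection : ∀ {K L} → BooleanCombination 𝒢 K → BooleanCombination 𝒢 L →
                   BooleanCombination 𝒢 (K ∩ L)
    same         : ∀ {K L} → K ≐ L → BooleanCombination 𝒢 K → BooleanCombination 𝒢 L

  ThresholdDotDepthOne : Language A → Set₁
  ThresholdDotDepthOne = BooleanCombination Generator

module _ (M : Monoid 0ℓ 0ℓ) where
  open Monoid M
  open RawMonoidDefinitions rawMonoid using () renaming (_×_ to _times_)

  -- The library writes powers additively.
  _^ᵐ_ : Carrier → ℕ → Carrier
  x ^ᵐ n = n times x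

  PositiveIdempotentExponent : ℕ → Set
  PositiveIdempotentExponent ω = 0 < ω × (∀ x → x ^ᵐ ω ≈ x ^ᵐ (2 ℕ.* ω))

  IdempotentPower : ℕ → Set
  IdempotentPower ω =
    PositiveIdempotentExponent ω × (∀ m → PositiveIdempotentExponent m → ω ≤ m)

  InJ : Set
  InJ = FiniteSetoid setoid ×
        (∃[ ω ] (IdempotentPower ω ×
                 (∀ x y → ((x ∙ y) ^ᵐ ω ≈ (x ∙ y) ^ᵐ ω ∙ x) ×
                          ((x ∙ y) ^ᵐ ω ∙ x ≈ y ∙ (x ∙ y) ^ᵐ ω))))

module _ (M : Monoid 0ℓ 0ℓ) (A : Set) where
  open Monoid M

  Instruction : ℕ → Set
  Instruction n = Fin n × (A → Carrier)

  Program : ℕ → Set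
  Program n = List (Instruction n)

module _ {M : Monoid 0ℓ 0ℓ} {A : Set} where
  open Monoid M

  output : ∀ {n} → Vec A n → Instruction M A n → Carrier
  output w (i , f) = f (Vec.lookup w i)

  run : ∀ {n} → Program M A n → Vec A n → Carrier
  run P w = List.foldr _∙_ ε (List.map (output w) P)

  -- Equality in M is the setoid equality _≈_, so a subset F of M is a
  -- predicate that respects it.
  Recognises : ∀ {n} → Program M A n → Pred (Vec A n) 0ℓ → Set₁
  Recognises P L =
    Σ[ F ∈ Pred Carrier 0ℓ ] (F Respects _≈_ × (∀ w → L w ⇔ F (run P w)))

restrict : ∀ {A : Set} → Language A → ∀ n → Pred (Vec A n) 0ℓ
restrict L n w = L (Vec.toList w)

-- The constant α may be taken to be a natural number: a real constant
-- can always be rounded up.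
InPJ : {A : Set} → Language A → Set₁
InPJ {A} L =
  Σ[ M ∈ Monoid 0ℓ 0ℓ ] (InJ M ×
    (∃[ α ] ∃[ j ] (0 < α ×
      (Σ[ P ∈ (∀ n → Program M A n) ]
        (∀ n → Recognises {M} (P n) (restrict L n) ×
               List.length (P n) ≤ α ℕ.* n ℕ.^ j)))))

-- Boolean combinations are handled by direct products, and "the output has v as a subword" by the
-- monoid of ascending maps of a finite chain. A non-empty word u with m letters is looked for
-- through a window sliding over the input: the window at a position outputs those indices j < m
-- for which the j-th letter of u is found in place, either twice in a row (plain reading) or four
-- times (sweep). Let J be the word of all m indices. If no window contains u, every window misses
-- an index, and the two readings have the same powers of J as subwords; if some window contains u,
-- the sweep has at least one more power of J than the plain reading. A large power of J in the
-- plain reading forces u ^ l to be a subword of the input. Hence, when u ^ l is not a subword, the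
-- factor u shows as a difference between two bounded counts.
--
-- For a product [u₁]ₗ ⋯ [uₖ]ₗ, choose for each i either the test for uᵢ ^ l or a sweep test with a
-- bounded exponent. The input belongs to the language iff for some choice it passes the
-- concatenated test, but fails every test obtained by demoting one sweep to a plain reading.
-- Soundness is immediate; for completeness cut the input greedily from the left, preferring the
-- test for uᵢ ^ l, then the largest sweep exponent, and always the shortest prefix that leaves a
-- remainder in the rest of the product.

module Submission where

open import Defs

open import Algebra.Bundles using (Monoid)
import Algebra.Construct.DirectProduct as DirectProduct
import Algebra.Properties.Monoid.Mult as Mult
open import Data.Bool.Base using (Bool; true; false; if_then_else_; _∧_; T)
open import Data.Bool.Properties using (T?; T-∧; T-≡)
open import Data.Empty using (⊥)
open import Data.Fin.Base as Fin using (Fin; zero; suc; toℕ; fromℕ)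
import Data.Fin.Properties as Fin
open import Data.List.Base as List using (List; []; _∷_; _++_; length; concatMap)
open import Data.List.Membership.Propositional using (_∈_)
open import Data.List.Membership.Propositional.Properties using (∈-allFin; ∈-++⁻; ∈-++⁺ˡ; ∈-++⁺ʳ; ∈-filter⁻)
open import Data.List.NonEmpty.Base as List⁺ using (List⁺; _∷_)
import Data.List.Properties as List
import Data.List.Relation.Binary.Sublist.DecPropositional as DecSublist
open import Data.List.Relation.Binary.Sublist.Propositional as Sublist
  using (_⊆_; []; _∷_; _∷ʳ_; minimum; ⊆-refl; ⊆-trans; ⊆-reflexive; from∈)
import Data.List.Relation.Binary.Sublist.Propositional.Properties as ⊆
open import Data.List.Relation.Unary.All as All using (All; []; _∷_)
import Data.List.Relation.Unary.All.Properties as All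
open import Data.List.Relation.Unary.AllPairs using ([]; _∷_)
open import Data.List.Relation.Unary.Any as Any using (here)
import Data.List.Relation.Unary.Any.Properties as Any
import Data.List.Relation.Unary.Enumerates.Setoid as Enumerates
import Data.List.Relation.Unary.Enumerates.Setoid.Properties as Enumeration
import Data.List.Relation.Unary.Unique.DecSetoid.Properties as UniqueDec
import Data.List.Relation.Unary.Unique.Setoid as Unique
open import Data.Maybe.Base using (Maybe; just; nothing)
open import Data.Maybe.Relation.Unary.Any as Maybe using (just)
open import Data.Nat.Base as ℕ using (ℕ; zero; suc; _+_; _*_; _∸_; _⊔_; _≤_; _<_; z≤n; s≤s; _≤ᵇ_; _≡ᵇ_)
import Data.Nat.Properties as ℕ
open import Data.Product.Base using (∃-syntax; Σ-syntax; _×_; _,_; proj₁; proj₂)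
open import Data.Product.Function.NonDependent.Propositional using (_×-⇔_)
open import Data.Product.Relation.Binary.Pointwise.NonDependent using (_×ₛ_)
open import Data.Sum.Base using (_⊎_; inj₁; inj₂; [_,_]′)
open import Data.Sum.Function.Propositional using (_⊎-⇔_)
import Data.Sum.Properties as Sum
open import Data.Unit.Base using (⊤; tt)
open import Data.Vec.Base as Vec using (Vec; []; _∷_)
open import Data.Vec.Properties using (toList∘fromList; length-toList)
open import Function.Base using (_∘_; id)
open import Function.Bundles using (Inverse; _⇔_; mk⇔; Equivalence)
import Function.Construct.Composition as Compose
import Function.Construct.Symmetry as Symmetry
open import Function.Properties.Inverse using (Inverse⇒Injection)
open import Level using (0ℓ)
open import Relation.Binary.Bundles using (Setoid; DecSetoid)
open import Relation.Binary.Definitions using (DecidableEquality)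
open import Relation.Binary.PropositionalEquality as ≡ using (_≡_; _≢_; refl; cong; cong₂; subst)
import Relation.Binary.Reasoning.Setoid as SetoidReasoning
open import Relation.Nullary using (¬_; Dec; yes; no; contradiction)
open import Relation.Nullary.Decidable using (isYes; toWitness; fromWitness; via-injection; _×-dec_; _⊎-dec_; _→-dec_)
open import Relation.Unary using (U; ∁; _∩_; _∪_; _≐_; Decidable; ｛_｝)

-- Finite setoids

module _ (S : DecSetoid 0ℓ 0ℓ) where
  open DecSetoid S hiding (refl)
  open Unique setoid using (Unique)
  open Enumerates setoid using (IsEnumeration)

  lookup-all : ∀ {P : Carrier → Set} {xs} → All P xs → ∀ i → P (List.lookup xs i)
  lookup-all (p ∷ _)  zero    = p
  lookup-all (_ ∷ ps) (suc i) = lookup-all ps i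

  lookup-injective : ∀ {xs} → Unique xs → ∀ i j → List.lookup xs i ≈ List.lookup xs j → i ≡ j
  lookup-injective (_ ∷ _)    zero    zero    _  = refl
  lookup-injective (x∉ ∷ _)   zero    (suc j) eq = contradiction eq (lookup-all x∉ j)
  lookup-injective (x∉ ∷ xs!) (suc i) zero    eq = ≡.sym (lookup-injective (x∉ ∷ xs!) zero (suc i) (sym eq))
  lookup-injective (_ ∷ xs!)  (suc i) (suc j) eq = cong suc (lookup-injective xs! i j eq)

  -- Deduplication leaves exactly one representative of every class, so the positions in the
  -- remaining list serve as the elements of `Fin`.
  enumeration⇒finite : ∀ {xs} → IsEnumeration xs → FiniteSetoid setoid
  enumeration⇒finite {xs} enum = length ys , record
    { to        = List.lookup ys
    ; from      = index
    ; to-cong   = λ { refl → Setoid.refl setoid }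
    ; from-cong = λ {x} {y} x≈y → injective (trans (sym (lookup-index x)) (trans x≈y (lookup-index y)))
    ; inverse   = (λ { {x} refl → sym (lookup-index x) })
                , (λ {i} {x} x≈ → injective (trans (sym (lookup-index x)) x≈))
    }
    where
    ys = List.deduplicate _≟_ xs
    complete = Enumeration.deduplicate⁺ S enum
    index : Carrier → Fin (length ys)
    index x = Any.index (complete x)
    lookup-index : ∀ x → x ≈ List.lookup ys (index x)
    lookup-index x = Any.lookup-index (complete x)
    injective : ∀ {i j} → List.lookup ys i ≈ List.lookup ys j → i ≡ j
    injective = lookup-injective (UniqueDec.deduplicate-! S xs) _ _

-- Closure of J under direct products

module _ {M : Monoid 0ℓ 0ℓ} (M∈J : InJ M) where
  open Monoid M renaming (refl to ≈-refl)
  open Mult M using (×-congʳ; ×-homo-+; ×-homo-1)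
  open SetoidReasoning setoid

  private
    ω = M∈J .proj₂ .proj₁
    infixl 8 _^_
    _^_ = _^ᵐ_ M

  -- The first equation of `InJ` with `y = ε` says that a further factor `x` does not change
  -- `x ^ ω`.
  J-stable-+ : ∀ x k → x ^ (ω + k) ≈ x ^ ω
  J-stable-+ x zero = reflexive (cong (x ^_) (ℕ.+-identityʳ ω))
  J-stable-+ x (suc k) = begin
    x ^ (ω + suc k)       ≡⟨ cong (x ^_) (≡.trans (ℕ.+-suc ω k) (ℕ.+-comm 1 (ω + k))) ⟩
    x ^ (ω + k + 1)       ≈⟨ ×-homo-+ x (ω + k) 1 ⟩
    x ^ (ω + k) ∙ x ^ 1   ≈⟨ ∙-cong (J-stable-+ x k) (×-homo-1 x) ⟩
    x ^ ω ∙ x             ≈⟨ ∙-congʳ (×-congʳ ω (identityʳ x)) ⟨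
    (x ∙ ε) ^ ω ∙ x       ≈⟨ M∈J .proj₂ .proj₂ .proj₂ x ε .proj₁ ⟨
    (x ∙ ε) ^ ω           ≈⟨ ×-congʳ ω (identityʳ x) ⟩
    x ^ ω                 ∎

  J-stable : ∀ x {m} → ω ≤ m → x ^ m ≈ x ^ ω
  J-stable x {m} ω≤m = begin
    x ^ m               ≡⟨ cong (x ^_) (ℕ.m+[n∸m]≡n ω≤m) ⟨
    x ^ (ω + (m ℕ.∸ ω)) ≈⟨ J-stable-+ x (m ℕ.∸ ω) ⟩
    x ^ ω               ∎

  -- The exponent of a direct product is the larger of two, so each factor needs its equations at
  -- exponents beyond its own.
  J-equations : ∀ x y {m} → ω ≤ m →
    ((x ∙ y) ^ m ≈ (x ∙ y) ^ m ∙ x) × ((x ∙ y) ^ m ∙ x ≈ y ∙ (x ∙ y) ^ m)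
  J-equations x y {m} ω≤m = (begin
      (x ∙ y) ^ m       ≈⟨ e ⟩
      (x ∙ y) ^ ω       ≈⟨ M∈J .proj₂ .proj₂ .proj₂ x y .proj₁ ⟩
      (x ∙ y) ^ ω ∙ x   ≈⟨ ∙-congʳ e ⟨
      (x ∙ y) ^ m ∙ x   ∎)
    , (begin
      (x ∙ y) ^ m ∙ x   ≈⟨ ∙-congʳ e ⟩
      (x ∙ y) ^ ω ∙ x   ≈⟨ M∈J .proj₂ .proj₂ .proj₂ x y .proj₂ ⟩
      y ∙ (x ∙ y) ^ ω   ≈⟨ ∙-congˡ e ⟨
      y ∙ (x ∙ y) ^ m   ∎)
    where
    e : (x ∙ y) ^ m ≈ (x ∙ y) ^ ω
    e = J-stable (x ∙ y) ω≤m

×-finite : ∀ {S T : Setoid 0ℓ 0ℓ} → FiniteSetoid S → FiniteSetoid T → FiniteSetoid (S ×ₛ T)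
×-finite {S} {T} (m , f) (n , g) = m * n , Compose.inverse (Fin.*↔× {m} {n}) (record
  { to        = λ (i , j) → F.to i , G.to j
  ; from      = λ (x , y) → F.from x , G.from y
  ; to-cong   = λ { refl → Setoid.refl S , Setoid.refl T }
  ; from-cong = λ (p , q) → ≡.cong₂ _,_ (F.from-cong p) (G.from-cong q)
  ; inverse   = (λ { refl → F.inverseˡ refl , G.inverseˡ refl })
              , (λ (p , q) → ≡.cong₂ _,_ (F.inverseʳ p) (G.inverseʳ q))
  })
  where
  module F = Inverse f
  module G = Inverse g

module _ (M N : Monoid 0ℓ 0ℓ) where

  private
    module M = Monoid M
    module N = Monoid N
    M×N = DirectProduct.monoid M N

  ×-power : ∀ x y n → _^ᵐ_ M×N (x , y) n ≡ (_^ᵐ_ M x n , _^ᵐ_ N y n)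
  ×-power x y zero    = refl
  ×-power x y (suc n) rewrite ×-power x y n = refl

  InJ-× : InJ M → InJ N → InJ M×N
  InJ-× M∈J@(M-fin , ω₁ , ((0<ω₁ , _) , ω₁-least) , _) N∈J@(N-fin , ω₂ , ((0<ω₂ , _) , ω₂-least) , _) =
    ×-finite M-fin N-fin , ω , ((0<ω , idem) , least) , equations
    where
    ω = ω₁ ⊔ ω₂
    0<ω = ℕ.<-≤-trans 0<ω₁ (ℕ.m≤m⊔n ω₁ ω₂)
    ω₁≤ω = ℕ.m≤m⊔n ω₁ ω₂
    ω₂≤ω = ℕ.m≤n⊔m ω₁ ω₂
    idem : ∀ z → Monoid._≈_ M×N (_^ᵐ_ M×N z ω) (_^ᵐ_ M×N z (2 * ω))
    idem (x , y) rewrite ×-power x y ω | ×-power x y (2 * ω) =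
      M.trans (J-stable {M} M∈J x ω₁≤ω) (M.sym (J-stable {M} M∈J x (ℕ.m≤n⇒m≤n+o _ ω₁≤ω))) ,
      N.trans (J-stable {N} N∈J y ω₂≤ω) (N.sym (J-stable {N} N∈J y (ℕ.m≤n⇒m≤n+o _ ω₂≤ω)))
    -- An exponent of the product is one of each factor, as pairs with one coordinate `ε` show.
    least : ∀ m → PositiveIdempotentExponent M×N m → ω ≤ m
    least m (0<m , m-idem) = ℕ.⊔-lub
      (ω₁-least m (0<m , λ x → proj₁ (component x N.ε)))
      (ω₂-least m (0<m , λ y → proj₂ (component M.ε y)))
      where
      component : ∀ x y → (_^ᵐ_ M x m M.≈ _^ᵐ_ M x (2 * m)) × (_^ᵐ_ N y m N.≈ _^ᵐ_ N y (2 * m))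
      component x y with m-idem (x , y)
      ... | p rewrite ×-power x y m | ×-power x y (2 * m) = p
    equations : ∀ z t → _
    equations (x₁ , x₂) (y₁ , y₂) rewrite ×-power (x₁ M.∙ y₁) (x₂ N.∙ y₂) ω
      with p₁ , q₁ ← J-equations {M} M∈J x₁ y₁ ω₁≤ω | p₂ , q₂ ← J-equations {N} N∈J x₂ y₂ ω₂≤ω = (p₁ , p₂) , (q₁ , q₂)

-- Ascending maps of a finite chain

module Chain (h : ℕ) where

  record Ascending : Set where
    constructor ascending
    field
      map       : Fin (suc h) → Fin (suc h)
      monotone  : ∀ {x y} → x Fin.≤ y → map x Fin.≤ map y
      extensive : ∀ x → x Fin.≤ map x

  open Ascending public

  monoid : Monoid 0ℓ 0ℓ
  monoid = record
    { Carrier = Ascending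
    ; _≈_     = λ f g → ∀ x → map f x ≡ map g x
    -- Diagrammatic order: the left factor acts first, just as a program produces its outputs from
    -- left to right.
    ; _∙_     = λ f g → ascending (map g ∘ map f) (monotone g ∘ monotone f)
                          (λ x → Fin.≤-trans (extensive f x) (extensive g (map f x)))
    ; ε       = ascending id id (λ _ → Fin.≤-refl)
    ; isMonoid = record
      { isSemigroup = record
        { isMagma = record
          { isEquivalence = record
            { refl  = λ _ → refl
            ; sym   = λ p x → ≡.sym (p x)
            ; trans = λ p q x → ≡.trans (p x) (q x)
            }
          ; ∙-cong = λ {f} {f′} {g} {g′} p q x → ≡.trans (cong (map g) (p x)) (q (map f′ x))
          }
        ; assoc = λ _ _ _ _ → refl
        }
      ; identity = (λ _ _ → refl) , (λ _ _ → refl)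
      }
    }

  open Monoid monoid using (_∙_; ε; _≈_; setoid)
  open Mult monoid using (×-homo-+)

  private
    infixl 8 _^_
    _^_ = _^ᵐ_ monoid

  decSetoid : DecSetoid 0ℓ 0ℓ
  decSetoid = record { isDecEquivalence = record
    { isEquivalence = Monoid.isEquivalence monoid
    ; _≟_ = λ f g → Fin.all? λ x → map f x Fin.≟ map g x } }

  private
    IsAscending : (Fin (suc h) → Fin (suc h)) → Set
    IsAscending f = (∀ x y → x Fin.≤ y → f x Fin.≤ f y) × (∀ x → x Fin.≤ f x)

    isAscending? : ∀ f → Dec (IsAscending f)
    isAscending? f =
      (Fin.all? λ x → Fin.all? λ y → (x Fin.≤? y) →-dec (f x Fin.≤? f y)) ×-dec
      (Fin.all? λ x → x Fin.≤? f x)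

    decode : Fin (suc h ℕ.^ suc h) → Maybe Ascending
    decode i with isAscending? (Fin.finToFun i)
    ... | yes (mono , ext) = just (ascending (Fin.finToFun i) (mono _ _) ext)
    ... | no  _            = nothing

    decode-encode : ∀ f → Maybe.Any (f ≈_) (decode (Fin.funToFin (map f)))
    decode-encode f with isAscending? (Fin.finToFun (Fin.funToFin (map f)))
    ... | yes _ = just λ x → ≡.sym (Fin.finToFun-funToFin (map f) x)
    ... | no ¬p = contradiction
      ( (λ x y x≤y → ≡.subst₂ Fin._≤_ (≡.sym (eq x)) (≡.sym (eq y)) (monotone f x≤y))
      , (λ x → subst (x Fin.≤_) (≡.sym (eq x)) (extensive f x)) ) ¬p
      where eq = Fin.finToFun-funToFin (map f)

  -- All self-maps of the chain are coded by numbers, and the codes of ascending maps are kept. The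
  -- proofs stored in an element do not matter, since equality compares values only.
  finite : FiniteSetoid setoid
  finite = enumeration⇒finite decSetoid {List.mapMaybe decode (List.allFin _)} λ f →
    Any.mapMaybe⁺ decode _ (Any.map⁺ (Any.map (λ { refl → decode-encode f })
      (∈-allFin (Fin.funToFin (map f)))))

  power-fixed : ∀ f k {x} → map f x ≡ x → map (f ^ k) x ≡ x
  power-fixed f zero    _  = refl
  power-fixed f (suc k) eq = ≡.trans (cong (map (f ^ k)) eq) (power-fixed f k eq)

  -- An extensive map gains at least one at every application until it meets a fixed point, where it
  -- then stays.
  power-climbs : ∀ f k x →
    map f (map (f ^ k) x) ≡ map (f ^ k) x ⊎ toℕ x + k ≤ toℕ (map (f ^ k) x)
  power-climbs f zero    x = inj₂ (ℕ.≤-reflexive (ℕ.+-identityʳ _))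
  power-climbs f (suc k) x with map f x Fin.≟ x
  ... | yes fx≡x = inj₁ (≡.trans (cong (map f) eq) (≡.trans fx≡x (≡.sym eq)))
    where eq = power-fixed f (suc k) fx≡x
  ... | no  fx≢x with power-climbs f k (map f x)
  ...   | inj₁ fixed = inj₁ fixed
  ...   | inj₂ climb = inj₂ (ℕ.≤-trans (ℕ.≤-reflexive (ℕ.+-suc _ k))
    (ℕ.≤-trans (ℕ.+-monoˡ-≤ k (Fin.≤∧≢⇒< (extensive f x) (fx≢x ∘ ≡.sym))) climb))

  -- A climb of `h` steps ends at the top of the chain, and the top is fixed by extensivity.
  power-h-fixed : ∀ f x → map f (map (f ^ h) x) ≡ map (f ^ h) x
  power-h-fixed f x with power-climbs f h x
  ... | inj₁ fixed = fixed
  ... | inj₂ climb = Fin.≤-antisym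
    (ℕ.≤-trans (Fin.toℕ≤pred[n] _) (ℕ.≤-trans (ℕ.m≤n+m h (toℕ x)) climb)) (extensive f _)

  power-suc : ∀ f k x → map f (map (f ^ k) x) ≡ map (f ^ k) (map f x)
  power-suc f zero    x = refl
  power-suc f (suc k) x = power-suc f k (map f x)

  -- All three maps equal `e`. A value of `e` is fixed by `f ∙ g`, and since both factors only move
  -- upwards, it is fixed by `f`. For `g ∙ e`, the value at `x` lies between `e` at `x` and `e`
  -- after `f ∙ g` at `x`, and these two agree.
  equations : ∀ f g → let e = (f ∙ g) ^ h in (e ≈ e ∙ f) × (e ∙ f ≈ g ∙ e)
  equations f g = (λ x → ≡.sym (fixed x)) , λ x → ≡.trans (fixed x) (Fin.≤-antisym
      (monotone e (extensive g x))
      (Fin.≤-trans (monotone e (monotone g (extensive f x)))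
        (Fin.≤-reflexive (≡.trans (≡.sym (power-suc (f ∙ g) h x)) (power-h-fixed (f ∙ g) x)))))
    where
    e = (f ∙ g) ^ h
    fixed : ∀ x → map f (map e x) ≡ map e x
    fixed x = Fin.≤-antisym
      (Fin.≤-trans (extensive g _) (Fin.≤-reflexive (power-h-fixed (f ∙ g) x)))
      (extensive f _)

  power-h-idempotent : ∀ f → f ^ h ≈ f ^ (2 * h)
  power-h-idempotent f x = ≡.sym (≡.trans (×-homo-+ f h (h + 0) x)
    (power-fixed f (h + 0) (power-h-fixed f x)))

  up : ∀ {h} → Fin (suc h) → Fin (suc h)
  up {zero}  zero    = zero
  up {suc h} zero    = suc zero
  up {suc h} (suc x) = suc (up x)

  toℕ-up : ∀ {h} (x : Fin (suc h)) → toℕ (up x) ≡ suc (toℕ x) ℕ.⊓ h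
  toℕ-up {zero}  zero    = refl
  toℕ-up {suc h} zero    = refl
  toℕ-up {suc h} (suc x) = cong suc (toℕ-up x)

  shift : Ascending
  shift = ascending up
    (λ {x} {y} x≤y → ≡.subst₂ _≤_ (≡.sym (toℕ-up x)) (≡.sym (toℕ-up y))
      (ℕ.⊓-monoˡ-≤ h (s≤s x≤y)))
    (λ x → subst (toℕ x ≤_) (≡.sym (toℕ-up x))
      (ℕ.⊓-glb (ℕ.n≤1+n _) (Fin.toℕ≤pred[n] x)))

  toℕ-shift-power : ∀ k x → toℕ (map (shift ^ k) x) ≡ (toℕ x + k) ℕ.⊓ h
  toℕ-shift-power zero    x =
    ≡.sym (≡.trans (cong (ℕ._⊓ h) (ℕ.+-identityʳ _)) (ℕ.m≤n⇒m⊓n≡m (Fin.toℕ≤pred[n] x)))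
  toℕ-shift-power (suc k) x = begin
    toℕ (map (shift ^ k) (up x))       ≡⟨ toℕ-shift-power k (up x) ⟩
    (toℕ (up x) + k) ℕ.⊓ h             ≡⟨ cong (λ t → (t + k) ℕ.⊓ h) (toℕ-up x) ⟩
    (suc (toℕ x) ℕ.⊓ h + k) ℕ.⊓ h      ≡⟨ cap (suc (toℕ x)) ⟩
    (suc (toℕ x) + k) ℕ.⊓ h            ≡⟨ cong (ℕ._⊓ h) (ℕ.+-suc (toℕ x) k) ⟨
    (toℕ x + suc k) ℕ.⊓ h              ∎
    where
    open ≡.≡-Reasoning
    cap : ∀ a → (a ℕ.⊓ h + k) ℕ.⊓ h ≡ (a + k) ℕ.⊓ h
    cap a with ℕ.≤-total a h
    ... | inj₁ a≤h = cong (λ t → (t + k) ℕ.⊓ h) (ℕ.m≤n⇒m⊓n≡m a≤h)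
    ... | inj₂ h≤a = ≡.trans (cong (λ t → (t + k) ℕ.⊓ h) (ℕ.m≥n⇒m⊓n≡n h≤a))
      (≡.trans (ℕ.m≥n⇒m⊓n≡n (ℕ.m≤m+n h k))
        (≡.sym (ℕ.m≥n⇒m⊓n≡n (ℕ.≤-trans h≤a (ℕ.m≤m+n a k)))))

  -- For `m < h` the map `shift` refutes idempotency: from the bottom, `m` steps reach exactly `m`,
  -- while `2 * m` steps get strictly higher before the cap `h` intervenes.
  idempotent⇒h≤ : ∀ m → PositiveIdempotentExponent monoid m → h ≤ m
  idempotent⇒h≤ m (0<m , idem) with ℕ.≤-<-connex h m
  ... | inj₁ h≤m = h≤m
  ... | inj₂ m<h = contradiction
    (≡.trans (≡.sym (ℕ.m≤n⇒m⊓n≡m (ℕ.<⇒≤ m<h)))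
      (≡.trans (≡.sym (toℕ-shift-power m zero))
        (≡.trans (cong toℕ (idem shift zero)) (toℕ-shift-power (2 * m) zero))))
    (ℕ.<⇒≢ (ℕ.⊓-glb (ℕ.m<m+n m (ℕ.<-≤-trans 0<m (ℕ.m≤m+n m 0))) m<h))

  inJ : 0 < h → InJ monoid
  inJ 0<h = finite , h , ((0<h , power-h-idempotent) , idempotent⇒h≤) , equations

infixr 4 _⟨⇔⟩_
_⟨⇔⟩_ : ∀ {X Y Z : Set} → X ⇔ Y → Y ⇔ Z → X ⇔ Z
_⟨⇔⟩_ = Compose.equivalence

¬-cong : ∀ {X Y : Set} → X ⇔ Y → (¬ X) ⇔ (¬ Y)
¬-cong X⇔Y = mk⇔ (_∘ Equivalence.from X⇔Y) (_∘ Equivalence.to X⇔Y)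

-- Closure properties of 𝒫(J)

module _ {A : Set} where

  run-++ : ∀ (M : Monoid 0ℓ 0ℓ) {n} (P Q : Program M A n) w →
    Monoid._≈_ M (run {M} (P ++ Q) w) (Monoid._∙_ M (run {M} P w) (run {M} Q w))
  run-++ M []      Q w = sym (identityˡ _)
    where open Monoid M
  run-++ M (I ∷ P) Q w = trans (∙-congˡ (run-++ M P Q w)) (sym (assoc _ _ _))
    where open Monoid M

  module _ (M N : Monoid 0ℓ 0ℓ) where
    private
      module M = Monoid M
      module N = Monoid N
      M×N = DirectProduct.monoid M N

    injectˡ : ∀ {n} → Instruction M A n → Instruction M×N A n
    injectˡ (i , f) = i , λ a → f a , N.ε

    injectʳ : ∀ {n} → Instruction N A n → Instruction M×N A n
    injectʳ (i , f) = i , λ a → M.ε , f a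

    _∥_ : ∀ {n} → Program M A n → Program N A n → Program M×N A n
    P ∥ Q = List.map injectˡ P ++ List.map injectʳ Q

    run-injectˡ : ∀ {n} (P : Program M A n) w →
      Monoid._≈_ M×N (run {M×N} (List.map injectˡ P) w) (run {M} P w , N.ε)
    run-injectˡ []      w = M.refl , N.refl
    run-injectˡ (I ∷ P) w =
      M.∙-congˡ (run-injectˡ P w .proj₁) , N.trans (N.identityˡ _) (run-injectˡ P w .proj₂)

    run-injectʳ : ∀ {n} (Q : Program N A n) w →
      Monoid._≈_ M×N (run {M×N} (List.map injectʳ Q) w) (M.ε , run {N} Q w)
    run-injectʳ []      w = M.refl , N.refl
    run-injectʳ (I ∷ Q) w =
      M.trans (M.identityˡ _) (run-injectʳ Q w .proj₁) , N.∙-congˡ (run-injectʳ Q w .proj₂)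

    run-∥ : ∀ {n} (P : Program M A n) (Q : Program N A n) w →
      Monoid._≈_ M×N (run {M×N} (P ∥ Q) w) (run {M} P w , run {N} Q w)
    run-∥ P Q w = trans (run-++ M×N (List.map injectˡ P) (List.map injectʳ Q) w)
      (trans (∙-cong (run-injectˡ P w) (run-injectʳ Q w)) (M.identityʳ _ , N.identityˡ _))
      where open Monoid M×N

  InPJ-constant : (X : Set) → InPJ {A} (λ _ → X)
  InPJ-constant X = Chain.monoid 1 , Chain.inJ 1 (s≤s z≤n) , 1 , 0 , s≤s z≤n , (λ _ → []) ,
    λ n → ((λ _ → X) , (λ _ → id) , (λ _ → mk⇔ id id)) , z≤n

  InPJ-map : ∀ (L : Language A) (op : Set → Set) → (∀ {X Y} → X ⇔ Y → op X ⇔ op Y) →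
    InPJ L → InPJ (op ∘ L)
  InPJ-map L op op-cong (M , M∈J , α , j , 0<α , P , spec) = M , M∈J , α , j , 0<α , P , λ n →
    let (F , F-resp , L⇔F) , bound = spec n in
    (op ∘ F , (λ x≈y → Equivalence.to (op-cong (mk⇔ (F-resp x≈y) (F-resp (Monoid.sym M x≈y))))) ,
      op-cong ∘ L⇔F) , bound

  InPJ-combine : ∀ (K L : Language A) (op : Set → Set → Set) →
    (∀ {X Y Z T} → X ⇔ Y → Z ⇔ T → op X Z ⇔ op Y T) →
    InPJ K → InPJ L → InPJ (λ w → op (K w) (L w))
  InPJ-combine K L op op-cong (M , M∈J , α , j , 0<α , P , P-spec) (N , N∈J , β , k , _ , Q , Q-spec) =
    DirectProduct.monoid M N , InJ-× M N M∈J N∈J , α + β , j + k , ℕ.<-≤-trans 0<α (ℕ.m≤m+n α β) ,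
    (λ n → _∥_ M N (P n) (Q n)) , λ n → recognises n , bound n (P n) (Q n) (proj₂ (P-spec n)) (proj₂ (Q-spec n))
    where
    module M = Monoid M
    module N = Monoid N
    recognises : ∀ n → Recognises {DirectProduct.monoid M N} (_∥_ M N (P n) (Q n))
      (λ w → op (restrict K n w) (restrict L n w))
    recognises n with F , F-resp , K⇔F ← proj₁ (P-spec n) | G , G-resp , L⇔G ← proj₁ (Q-spec n) =
      (λ z → op (F (proj₁ z)) (G (proj₂ z))) ,
      (λ z≈t → Equivalence.to (op-cong (F⇔ (proj₁ z≈t)) (G⇔ (proj₂ z≈t)))) ,
      λ w → let p , q = run-∥ M N (P n) (Q n) w in
        op-cong (K⇔F w ⟨⇔⟩ F⇔ (M.sym p)) (L⇔G w ⟨⇔⟩ G⇔ (N.sym q))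
      where
      F⇔ : ∀ {x y} → x M.≈ y → F x ⇔ F y
      F⇔ x≈y = mk⇔ (F-resp x≈y) (F-resp (M.sym x≈y))
      G⇔ : ∀ {x y} → x N.≈ y → G x ⇔ G y
      G⇔ x≈y = mk⇔ (G-resp x≈y) (G-resp (N.sym x≈y))

    bound : ∀ n (P : Program M A n) (Q : Program N A n) →
      length P ≤ α * n ℕ.^ j → length Q ≤ β * n ℕ.^ k → length (_∥_ M N P Q) ≤ (α + β) * n ℕ.^ (j + k)
    -- Powers of 0 are not monotone in the exponent, as `0 ^ 0` is 1. But inputs of length 0 have no
    -- position to query, so both programs are empty.
    bound zero []             []             _ _ = z≤n
    bound zero []             ((() , _) ∷ _) _ _
    bound zero ((() , _) ∷ _) _              _ _
    bound n@(suc _) P Q p q = begin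
      length (_∥_ M N P Q)                             ≡⟨ List.length-++ (List.map (injectˡ M N) P) ⟩
      length (List.map (injectˡ M N) P) + length (List.map (injectʳ M N) Q)
        ≡⟨ ≡.cong₂ _+_ (List.length-map (injectˡ M N) P) (List.length-map (injectʳ M N) Q) ⟩
      length P + length Q                              ≤⟨ ℕ.+-mono-≤ p q ⟩
      α * n ℕ.^ j + β * n ℕ.^ k
        ≤⟨ ℕ.+-mono-≤ (ℕ.*-monoʳ-≤ α (ℕ.^-monoʳ-≤ n (ℕ.m≤m+n j k))) (ℕ.*-monoʳ-≤ β (ℕ.^-monoʳ-≤ n (ℕ.m≤n+m k j))) ⟩
      α * n ℕ.^ (j + k) + β * n ℕ.^ (j + k)            ≡⟨ ℕ.*-distribʳ-+ (n ℕ.^ (j + k)) α β ⟨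
      (α + β) * n ℕ.^ (j + k)                          ∎
      where open ℕ.≤-Reasoning

  InPJ-resp-≐ : ∀ (K L : Language A) → K ≐ L → InPJ K → InPJ L
  InPJ-resp-≐ K L (K⊆L , L⊆K) (M , M∈J , α , j , 0<α , P , spec) = M , M∈J , α , j , 0<α , P , λ n →
    let (F , F-resp , K⇔F) , bound = spec n in
    (F , F-resp , λ w → mk⇔ L⊆K K⊆L ⟨⇔⟩ K⇔F w) , bound

  InPJ-∁ : ∀ (L : Language A) → InPJ L → InPJ (∁ L)
  InPJ-∁ L = InPJ-map L ¬_ ¬-cong

  InPJ-∪ : ∀ (K L : Language A) → InPJ K → InPJ L → InPJ (K ∪ L)
  InPJ-∪ K L = InPJ-combine K L _⊎_ _⊎-⇔_

  InPJ-∩ : ∀ (K L : Language A) → InPJ K → InPJ L → InPJ (K ∩ L)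
  InPJ-∩ K L = InPJ-combine K L _×_ _×-⇔_

  -- The intersection is a fold because the index type, later lists of tests, lives in `Set₁`; a
  -- quantifier over it would leave the universe of languages.
  InPJ-⋂ : ∀ {I : Set₁} (Q : I → Language A) is → (∀ i → InPJ (Q i)) →
    InPJ (List.foldr (λ i K → Q i ∩ K) U is)
  InPJ-⋂ Q []       Q∈ = InPJ-constant ⊤
  InPJ-⋂ Q (i ∷ is) Q∈ = InPJ-∩ (Q i) (List.foldr (λ i K → Q i ∩ K) U is) (Q∈ i) (InPJ-⋂ Q is Q∈)

  InPJ-⋃-Fin : ∀ {n} (Q : Fin n → Language A) → (∀ i → InPJ (Q i)) → InPJ (λ w → ∃[ i ] Q i w)
  InPJ-⋃-Fin {zero}  Q Q∈ = InPJ-resp-≐ (λ _ → ⊥) (λ w → ∃[ i ] Q i w) ((λ ()) , (λ ())) (InPJ-constant ⊥)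
  InPJ-⋃-Fin {suc n} Q Q∈ = InPJ-resp-≐ (Q zero ∪ λ w → ∃[ i ] Q (suc i) w) (λ w → ∃[ i ] Q i w)
    ( (λ { (inj₁ q) → zero , q ; (inj₂ (i , q)) → suc i , q })
    , (λ { (zero , q) → inj₁ q ; (suc i , q) → inj₂ (i , q) }))
    (InPJ-∪ (Q zero) (λ w → ∃[ i ] Q (suc i) w) (Q∈ zero) (InPJ-⋃-Fin (Q ∘ suc) (Q∈ ∘ suc)))

-- Programs whose output has a fixed subword

emit : ∀ {A B : Set} {n} → Vec A n → Fin n × (A → List B) → List B
emit w (i , f) = f (Vec.lookup w i)

module _ {B : Set} (_≟_ : DecidableEquality B) where

  -- A state is the number of letters of `v` found so far.
  advance : ∀ (v : List B) → B → Fin (suc (length v)) → Fin (suc (length v))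
  advance []      b zero    = zero
  advance (c ∷ v) b (suc x) = suc (advance v b x)
  advance (c ∷ v) b zero with c ≟ b
  ... | yes _ = suc zero
  ... | no  _ = zero

  advance-monotone : ∀ (v : List B) b {x y} → x Fin.≤ y → advance v b x Fin.≤ advance v b y
  advance-monotone []      b {zero}  {zero}  _ = z≤n
  advance-monotone (c ∷ v) b {zero}  {zero}  _ = Fin.≤-refl
  advance-monotone (c ∷ v) b {suc x} {suc y} (s≤s x≤y) = s≤s (advance-monotone v b x≤y)
  advance-monotone (c ∷ v) b {zero}  {suc y} _ with c ≟ b
  ... | yes _ = s≤s z≤n
  ... | no  _ = z≤n

  advance-extensive : ∀ (v : List B) b x → x Fin.≤ advance v b x
  advance-extensive v       b zero    = z≤n
  advance-extensive (c ∷ v) b (suc x) = s≤s (advance-extensive v b x)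

  module _ (v : List B) where
    open Chain (length v)
    open Monoid monoid using (_∙_; ε; _≈_)

    act : List B → Ascending
    act []      = ε
    act (b ∷ z) = ascending (advance v b) (advance-monotone v b) (advance-extensive v b) ∙ act z

    act-++ : ∀ y z → act (y ++ z) ≈ act y ∙ act z
    act-++ []      z x = refl
    act-++ (b ∷ y) z x = act-++ y z _

    -- Greedy matching is optimal: if the next letter of `v` is at hand, taking it at once never
    -- spoils a match of the rest.
    act-top : ∀ z x → map (act z) x ≡ fromℕ (length v) ⇔ List.drop (toℕ x) v ⊆ z
    act-top []      x = done v x
      where
      done : ∀ (v : List B) x → x ≡ fromℕ (length v) ⇔ List.drop (toℕ x) v ⊆ []
      done []      zero    = mk⇔ (λ _ → []) (λ _ → refl)
      done (c ∷ v) zero    = mk⇔ (λ ()) (λ ())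
      done (c ∷ v) (suc x) = mk⇔ Fin.suc-injective (cong suc) ⟨⇔⟩ done v x
    act-top (b ∷ z) x = act-top z (advance v b x) ⟨⇔⟩ greedy v x
      where
      greedy : ∀ (v : List B) x → List.drop (toℕ (advance v b x)) v ⊆ z ⇔ List.drop (toℕ x) v ⊆ b ∷ z
      greedy []      zero    = mk⇔ (λ _ → minimum _) (λ _ → minimum _)
      greedy (c ∷ v) (suc x) = greedy v x
      greedy (c ∷ v) zero with c ≟ b
      ... | yes c≡b = ⊆.∷⁻¹ c≡b
      ... | no  c≢b = ⊆.∷ʳ⁻¹ c≢b

  module _ {A : Set} where

    InPJ-subword : ∀ (L : Language A) (v : List B) (I : ∀ n → List (Fin n × (A → List B))) c →
      (∀ n → length (I n) ≤ c * n) →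
      (∀ n (w : Vec A n) → L (Vec.toList w) ⇔ v ⊆ concatMap (emit w) (I n)) → InPJ L
    -- The chain of an empty `v` has height 0, to which `inJ` does not apply; but an empty subword
    -- is always present, so `L` contains every word.
    InPJ-subword L []        I c bound spec = InPJ-resp-≐ U L
      ((λ {w} _ → all w) , (λ _ → tt)) (InPJ-constant ⊤)
      where
      all : ∀ w → L w
      all w = subst L (toList∘fromList w) (Equivalence.from (spec _ (Vec.fromList w)) (minimum _))
    InPJ-subword L v@(_ ∷ _) I c bound spec =
      -- The constant is `suc c`, so that it is positive even for `c = 0`.
      monoid , inJ (s≤s z≤n) , suc c , 1 , s≤s z≤n , P , λ n →
      ( (λ g → map g zero ≡ fromℕ (length v)) , (λ x≈y → ≡.trans (≡.sym (x≈y zero))) ,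
        (λ w → spec n w ⟨⇔⟩ Symmetry.⇔-sym (act-top v _ zero) ⟨⇔⟩
          ≡-⇔ {run {monoid} (P n) w} {act v (concatMap (emit w) (I n))} (run-P w (I n)))) ,
      length-P n
      where
      open Chain (length v)
      compile : ∀ {n} → Fin n × (A → List B) → Instruction monoid A n
      compile (i , f) = i , act v ∘ f
      P : ∀ n → Program monoid A n
      P n = List.map compile (I n)
      run-P : ∀ {n} w (I : List (Fin n × (A → List B))) →
        Monoid._≈_ monoid (run {monoid} (List.map compile I) w) (act v (concatMap (emit w) I))
      run-P w []            x = refl
      run-P w ((i , f) ∷ I) x = ≡.trans (run-P w I _) (≡.sym (act-++ v (f (Vec.lookup w i)) _ x))
      ≡-⇔ : ∀ {g h : Ascending} {t} → Monoid._≈_ monoid g h → (map h zero ≡ t) ⇔ (map g zero ≡ t)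
      ≡-⇔ g≈h = mk⇔ (≡.trans (g≈h zero)) (≡.trans (≡.sym (g≈h zero)))
      length-P : ∀ n → length (P n) ≤ suc c * n ℕ.^ 1
      length-P n = begin
        length (P n)     ≡⟨ List.length-map compile (I n) ⟩
        length (I n)     ≤⟨ bound n ⟩
        c * n            ≤⟨ ℕ.m≤n+m (c * n) n ⟩
        suc c * n        ≡⟨ cong (suc c *_) (ℕ.*-identityʳ n) ⟨
        suc c * n ℕ.^ 1  ∎
        where open ℕ.≤-Reasoning

⊆-respʳ : ∀ {B : Set} {x y z : List B} → y ≡ z → x ⊆ y → x ⊆ z
⊆-respʳ refl p = p

⊆-respˡ : ∀ {B : Set} {x y z : List B} → x ≡ y → x ⊆ z → y ⊆ z
⊆-respˡ refl p = p

-- Readers sliding over the input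

module _ {A : Set} where

  -- The guard sees only how many letters follow the one being read. This depends on the position
  -- and the input length alone, so the guard is decided when the program is built and costs no
  -- instruction.
  record Atom (B : Set) : Set where
    constructor atom
    field
      offset : ℕ
      guard  : ℕ → Bool
      letter : A → List B

  readAtom : ∀ {B} → Atom B → List A → List B
  readAtom (atom _       _ _) []      = []
  readAtom (atom zero    g f) (a ∷ y) = if g (length y) then f a else []
  readAtom (atom (suc p) g f) (_ ∷ y) = readAtom (atom p g f) y

  read : ∀ {B} → List (Atom B) → List A → List B
  read R y = concatMap (λ r → readAtom r y) R

  scan : ∀ {B} → List (Atom B) → List A → List B
  scan R []      = []
  scan R (a ∷ y) = read R (a ∷ y) ++ scan R y

  module _ {B : Set} where

    read-[] : (R : List (Atom B)) → read R [] ≡ []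
    read-[] []      = refl
    read-[] (r ∷ R) = read-[] R

    read⊆scan : ∀ (R : List (Atom B)) y → read R y ⊆ scan R y
    read⊆scan R []      = ⊆-reflexive (read-[] R)
    read⊆scan R (a ∷ y) = ⊆.++⁺ʳ _ ⊆-refl

    scan-++ʳ : ∀ (R : List (Atom B)) x y → scan R y ⊆ scan R (x ++ y)
    scan-++ʳ R []      y = ⊆-refl
    scan-++ʳ R (a ∷ x) y = ⊆.++⁺ˡ (read R (a ∷ x ++ y)) (scan-++ʳ R x y)

    shift : ∀ {n} → Fin n × (A → List B) → Fin (suc n) × (A → List B)
    shift (i , f) = suc i , f

    place : ∀ n → Atom B → List (Fin n × (A → List B))
    place zero    _                  = []
    place (suc n) (atom zero    g f) = if g n then (zero , f) ∷ [] else []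
    place (suc n) (atom (suc p) g f) = List.map shift (place n (atom p g f))

    emit-shift : ∀ {n} a (w : Vec A n) (I : List (Fin n × (A → List B))) →
      concatMap (emit (a ∷ w)) (List.map shift I) ≡ concatMap (emit w) I
    emit-shift a w []            = refl
    emit-shift a w ((i , f) ∷ I) = cong (f (Vec.lookup w i) ++_) (emit-shift a w I)

    emit-place : ∀ {n} r (w : Vec A n) →
      concatMap (emit w) (place n r) ≡ readAtom r (Vec.toList w)
    emit-place r                  []      = refl
    emit-place (atom (suc p) g f) (a ∷ w) = ≡.trans (emit-shift a w (place _ (atom p g f))) (emit-place (atom p g f) w)
    emit-place {suc n} (atom zero g f) (a ∷ w) rewrite length-toList w with g n
    ... | true  = List.++-identityʳ (f a)
    ... | false = refl

    length-place : ∀ n r → length (place n r) ≤ 1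
    length-place zero    r               = z≤n
    length-place (suc n) (atom zero g f) with g n
    ... | true  = s≤s z≤n
    ... | false = z≤n
    length-place (suc n) (atom (suc p) g f) =
      subst (_≤ 1) (≡.sym (List.length-map shift (place n (atom p g f)))) (length-place n (atom p g f))

    readProgram : List (Atom B) → ∀ n → List (Fin n × (A → List B))
    readProgram R n = concatMap (place n) R

    scanProgram : List (Atom B) → ∀ n → List (Fin n × (A → List B))
    scanProgram R zero    = []
    scanProgram R (suc n) = readProgram R (suc n) ++ List.map shift (scanProgram R n)

    emit-readProgram : ∀ R {n} (w : Vec A n) →
      concatMap (emit w) (readProgram R n) ≡ read R (Vec.toList w)
    emit-readProgram []      w = refl
    emit-readProgram (r ∷ R) w = ≡.trans (List.concatMap-++ (emit w) (place _ r) _)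
      (cong₂ _++_ (emit-place r w) (emit-readProgram R w))

    emit-scanProgram : ∀ R {n} (w : Vec A n) →
      concatMap (emit w) (scanProgram R n) ≡ scan R (Vec.toList w)
    emit-scanProgram R []      = refl
    emit-scanProgram R (a ∷ w) = ≡.trans (List.concatMap-++ (emit (a ∷ w)) (readProgram R _) _)
      (cong₂ _++_ (emit-readProgram R (a ∷ w)) (≡.trans (emit-shift a w (scanProgram R _)) (emit-scanProgram R w)))

    length-readProgram : ∀ R n → length (readProgram R n) ≤ length R
    length-readProgram []      n = z≤n
    length-readProgram (r ∷ R) n = ℕ.≤-trans (ℕ.≤-reflexive (List.length-++ (place n r)))
      (ℕ.+-mono-≤ (length-place n r) (length-readProgram R n))

    length-readProgram-* : ∀ R n → length (readProgram R n) ≤ length R * n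
    length-readProgram-* []      zero    = z≤n
    length-readProgram-* (r ∷ R) zero    = length-readProgram-* R zero
    length-readProgram-* R       (suc n) =
      ℕ.≤-trans (length-readProgram R (suc n)) (ℕ.m≤m*n (length R) (suc n))

    length-scanProgram : ∀ R n → length (scanProgram R n) ≤ length R * n
    length-scanProgram R zero    = z≤n
    length-scanProgram R (suc n) = begin
      length (scanProgram R (suc n)) ≡⟨ List.length-++ (readProgram R (suc n)) ⟩
      length (readProgram R (suc n)) + length (List.map shift (scanProgram R n))
        ≤⟨ ℕ.+-mono-≤ (length-readProgram R (suc n))
             (ℕ.≤-trans (ℕ.≤-reflexive (List.length-map shift (scanProgram R n))) (length-scanProgram R n)) ⟩
      length R + length R * n        ≡⟨ ℕ.*-suc (length R) n ⟨
      length R * suc n               ∎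
      where open ℕ.≤-Reasoning

    module _ (_≟_ : DecidableEquality B) (v : List B) (R : List (Atom B)) where

      InPJ-read : InPJ (λ w → v ⊆ read R w)
      InPJ-read = InPJ-subword _≟_ (λ w → v ⊆ read R w) v (readProgram R) (length R) (length-readProgram-* R)
        λ n w → mk⇔ (⊆-respʳ (≡.sym (emit-readProgram R w))) (⊆-respʳ (emit-readProgram R w))

      InPJ-scan : InPJ (λ w → v ⊆ scan R w)
      InPJ-scan = InPJ-subword _≟_ (λ w → v ⊆ scan R w) v (scanProgram R) (length R) (length-scanProgram R)
        λ n w → mk⇔ (⊆-respʳ (≡.sym (emit-scanProgram R w))) (⊆-respʳ (emit-scanProgram R w))

  -- Concatenation of scans

  module _ {B C : Set} where

    tag : Atom B → Atom (B ⊎ C)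
    tag (atom p g f) = atom p g (List.map inj₁ ∘ f)

    delay : ℕ → Atom C → Atom (B ⊎ C)
    delay m (atom p g f) = atom (m + p) g (List.map inj₂ ∘ f)

    -- The second reader lags one window behind, so that it reads only
    -- what follows the windows already read by the first one.
    _▹[_]_ : List (Atom B) → ℕ → List (Atom C) → List (Atom (B ⊎ C))
    R ▹[ m ] R′ = List.map tag R ++ List.map (delay m) R′

    readAtom-tag : ∀ r y → readAtom (tag r) y ≡ List.map inj₁ (readAtom r y)
    readAtom-tag (atom zero    g f) []      = refl
    readAtom-tag (atom (suc p) g f) []      = refl
    readAtom-tag (atom (suc p) g f) (a ∷ y) = readAtom-tag (atom p g f) y
    readAtom-tag (atom zero    g f) (a ∷ y) with g (length y)
    ... | true  = refl
    ... | false = refl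

    readAtom-delay : ∀ m r y → readAtom (delay m r) y ≡ List.map inj₂ (readAtom r (List.drop m y))
    readAtom-delay (suc m) (atom p       g f) []      = refl
    readAtom-delay (suc m) (atom p       g f) (a ∷ y) = readAtom-delay m (atom p g f) y
    readAtom-delay zero    (atom zero    g f) []      = refl
    readAtom-delay zero    (atom (suc p) g f) []      = refl
    readAtom-delay zero    (atom (suc p) g f) (a ∷ y) = readAtom-delay zero (atom p g f) y
    readAtom-delay zero    (atom zero    g f) (a ∷ y) with g (length y)
    ... | true  = refl
    ... | false = refl

    read-▹ : ∀ R m R′ y → read (R ▹[ m ] R′) y ≡
      List.map inj₁ (read R y) ++ List.map inj₂ (read R′ (List.drop m y))
    read-▹ (r ∷ R) m R′ y = ≡.trans (cong₂ _++_ (readAtom-tag r y) (read-▹ R m R′ y))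
      (≡.trans (≡.sym (List.++-assoc (List.map inj₁ (readAtom r y)) _ _))
        (cong (_++ _) (≡.sym (List.map-++ inj₁ (readAtom r y) (read R y)))))
    read-▹ [] m []       y = refl
    read-▹ [] m (r ∷ R′) y = ≡.trans (cong₂ _++_ (readAtom-delay m r y) (read-▹ [] m R′ y))
      (≡.sym (List.map-++ inj₂ (readAtom r (List.drop m y)) _))

    rights : List (B ⊎ C) → List C
    rights []           = []
    rights (inj₁ _ ∷ z) = rights z
    rights (inj₂ c ∷ z) = c ∷ rights z

    rights-⊆ : ∀ {y z} → y ⊆ z → rights y ⊆ rights z
    rights-⊆ []                     = []
    rights-⊆ (inj₁ _ ∷ʳ p)          = rights-⊆ p
    rights-⊆ (inj₂ c ∷ʳ p)          = c ∷ʳ rights-⊆ p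
    rights-⊆ (_∷_ {inj₁ _} refl p)  = rights-⊆ p
    rights-⊆ (_∷_ {inj₂ _} refl p)  = refl ∷ rights-⊆ p

    rights-inj₁-++ : ∀ y z → rights (List.map inj₁ y ++ z) ≡ rights z
    rights-inj₁-++ []      z = refl
    rights-inj₁-++ (_ ∷ y) z = rights-inj₁-++ y z

    rights-inj₂-++ : ∀ y z → rights (List.map inj₂ y ++ z) ≡ y ++ rights z
    rights-inj₂-++ []      z = refl
    rights-inj₂-++ (c ∷ y) z = cong (c ∷_) (rights-inj₂-++ y z)

    rights-inj₂ : ∀ y → rights (List.map inj₂ y) ≡ y
    rights-inj₂ []      = refl
    rights-inj₂ (c ∷ y) = cong (c ∷_) (rights-inj₂ y)

    -- No letter of `V` can be found among the left letters of `y`, so the pattern is cut inside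
    -- `v`.
    ⊆-split-inj₁ : ∀ (v : List B) (V : List C) (y : List B) {z} →
      List.map inj₁ v ++ List.map inj₂ V ⊆ List.map inj₁ y ++ z →
      ∃[ p ] ∃[ q ] (v ≡ p ++ q × p ⊆ y × List.map inj₁ q ++ List.map inj₂ V ⊆ z)
    ⊆-split-inj₁ v       V       []      s          = [] , v , refl , [] , s
    ⊆-split-inj₁ []      []      (_ ∷ _) _          = [] , [] , refl , minimum _ , minimum _
    ⊆-split-inj₁ []      (c ∷ V) (b ∷ y) (_ ∷ʳ s)   with p , q , eq , p⊆ , q⊆ ← ⊆-split-inj₁ [] (c ∷ V) y s =
      p , q , eq , b ∷ʳ p⊆ , q⊆
    ⊆-split-inj₁ (d ∷ v) V       (b ∷ y) (_ ∷ʳ s)   with p , q , eq , p⊆ , q⊆ ← ⊆-split-inj₁ (d ∷ v) V y s =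
      p , q , eq , b ∷ʳ p⊆ , q⊆
    ⊆-split-inj₁ (_ ∷ v) V       (b ∷ y) (refl ∷ s) with p , q , eq , p⊆ , q⊆ ← ⊆-split-inj₁ v V y s =
      b ∷ p , q , cong (b ∷_) eq , refl ∷ p⊆ , q⊆

    ⊆-skip-inj₂ : ∀ {b : B} {v} (y : List C) {z} → inj₁ b ∷ v ⊆ List.map inj₂ y ++ z → inj₁ b ∷ v ⊆ z
    ⊆-skip-inj₂ []      s        = s
    ⊆-skip-inj₂ (c ∷ y) (_ ∷ʳ s) = ⊆-skip-inj₂ y s

  -- Either nothing is left after `m` letters and both sides are empty, or the longer remainder has
  -- exactly one more letter in front.
  scan-drop : ∀ {C} (R : List (Atom C)) m a w →
    read R (List.drop m (a ∷ w)) ++ scan R (List.drop m w) ≡ scan R (List.drop m (a ∷ w))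
  scan-drop R zero          a w       = refl
  scan-drop R (suc m)       a (b ∷ w) = scan-drop R m b w
  scan-drop R (suc zero)    a []      = cong (_++ []) (read-[] R)
  scan-drop R (suc (suc m)) a []      = cong (_++ []) (read-[] R)

  -- By `local` and `short` a reading depends on one window of `width` letters, and windows that do
  -- not fit are silent. As the pattern is not empty, a word that passes has room for at least one
  -- window; concatenation relies on this.
  record Test : Set₁ where
    field
      {Letter} : Set
      _≟_      : DecidableEquality Letter
      width    : ℕ
      reader   : List (Atom Letter)
      pattern⁺ : List⁺ Letter
      local    : ∀ x y → width ≤ length x → read reader (x ++ y) ≡ read reader x
      short    : ∀ x → length x < width → read reader x ≡ []

    ⟦_⟧ : Language A
    ⟦_⟧ x = List⁺.toList pattern⁺ ⊆ scan reader x

    scan-short : ∀ x → length x < width → scan reader x ≡ []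
    scan-short []      _   = refl
    scan-short (a ∷ x) x<m = cong₂ _++_ (short (a ∷ x) x<m) (scan-short x (ℕ.<-trans (ℕ.n<1+n _) x<m))

    read-++ˡ : ∀ x y → read reader x ⊆ read reader (x ++ y)
    read-++ˡ x y with width ℕ.≤? length x
    ... | yes m≤x = ⊆-reflexive (≡.sym (local x y m≤x))
    ... | no  m≰x = ⊆-respˡ (≡.sym (short x (ℕ.≰⇒> m≰x))) (minimum _)

    scan-++ˡ : ∀ x y → scan reader x ⊆ scan reader (x ++ y)
    scan-++ˡ []      y = minimum _
    scan-++ˡ (a ∷ x) y = ⊆.++⁺ (read-++ˡ (a ∷ x) y) (scan-++ˡ x y)

    ⟦⟧-++ˡ : ∀ x y → ⟦_⟧ x → ⟦_⟧ (x ++ y)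
    ⟦⟧-++ˡ x y s = ⊆-trans s (scan-++ˡ x y)

    ⟦⟧-++ʳ : ∀ x y → ⟦_⟧ y → ⟦_⟧ (x ++ y)
    ⟦⟧-++ʳ x y s = ⊆-trans s (scan-++ʳ reader x y)

    ⟦⟧? : Decidable ⟦_⟧
    ⟦⟧? x = List⁺.toList pattern⁺ ⊆? scan reader x
      where open DecSublist _≟_ using (_⊆?_)

    width≤ : ∀ {b v} x → b ∷ v ⊆ scan reader x → width ≤ length x
    width≤ x s with width ℕ.≤? length x
    ... | yes m≤x = m≤x
    ... | no  m≰x with ⊆-respʳ (scan-short x (ℕ.≰⇒> m≰x)) s
    ...   | ()

    module _ {C : Set} (R′ : List (Atom C)) where

      private
        R  = reader
        m  = width
        S  = R ▹[ m ] R′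

      scan-▹-cons : ∀ a w → scan S (a ∷ w) ≡
        List.map inj₁ (read R (a ∷ w)) ++ (List.map inj₂ (read R′ (List.drop m (a ∷ w))) ++ scan S w)
      scan-▹-cons a w = ≡.trans (cong (_++ scan S w) (read-▹ R m R′ (a ∷ w)))
        (List.++-assoc (List.map inj₁ (read R (a ∷ w))) _ _)

      rights-scan : ∀ w → rights (scan S w) ⊆ scan R′ (List.drop m w)
      rights-scan []      = minimum _
      rights-scan (a ∷ w) rewrite scan-▹-cons a w
        | rights-inj₁-++ {C = C} (read R (a ∷ w)) (List.map inj₂ (read R′ (List.drop m (a ∷ w))) ++ scan S w)
        | rights-inj₂-++ {B = Letter} (read R′ (List.drop m (a ∷ w))) (scan S w) =
        ⊆-respʳ (scan-drop R′ m a w) (⊆.++⁺ {as = read R′ (List.drop m (a ∷ w))} ⊆-refl (rights-scan w))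

      scan-lag⊆step : ∀ a w → List.map inj₂ (scan R′ (List.drop m w)) ⊆ scan S w →
        List.map inj₂ (scan R′ (List.drop m (a ∷ w))) ⊆ List.map inj₂ (read R′ (List.drop m (a ∷ w))) ++ scan S w
      scan-lag⊆step a w s rewrite ≡.sym (scan-drop R′ m a w)
        | List.map-++ (inj₂ {A = Letter}) (read R′ (List.drop m (a ∷ w))) (scan R′ (List.drop m w)) =
        ⊆.++⁺ ⊆-refl s

      scan-lag⊆ : ∀ w → List.map inj₂ (scan R′ (List.drop m w)) ⊆ scan S w
      scan-lag⊆ [] with m
      ... | zero  = []
      ... | suc _ = []
      scan-lag⊆ (a ∷ w) = ⊆-respʳ (≡.sym (scan-▹-cons a w))
        (⊆.++⁺ˡ (List.map inj₁ (read R (a ∷ w))) (scan-lag⊆step a w (scan-lag⊆ w)))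

      -- Only the first reader is used as long as its windows fit into `x`. At the last such window
      -- the lagging reader stands exactly at the start of `y`, and from there it reads all of `y`.
      scan-▹-++ : ∀ x y → m ≤ length x →
        List.map inj₁ (scan R x) ++ List.map inj₂ (scan R′ y) ⊆ scan S (x ++ y)
      scan-▹-++ [] y m≤0 = subst (λ k → List.map inj₂ (scan R′ (List.drop k y)) ⊆ scan S y)
        (ℕ.n≤0⇒n≡0 m≤0) (scan-lag⊆ y)
      scan-▹-++ (a ∷ x) y m≤ with m ℕ.≤? length x
      ... | yes m≤x rewrite List.map-++ (inj₁ {B = C}) (read R (a ∷ x)) (scan R x)
                          | List.++-assoc (List.map (inj₁ {B = C}) (read R (a ∷ x)))
                              (List.map inj₁ (scan R x)) (List.map inj₂ (scan R′ y))
                          | scan-▹-cons a (x ++ y) | local (a ∷ x) y m≤ =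
        ⊆.++⁺ {as = List.map inj₁ (read R (a ∷ x))} ⊆-refl
          (⊆.++⁺ˡ (List.map inj₂ (read R′ (List.drop m (a ∷ x ++ y)))) (scan-▹-++ x y m≤x))
      ... | no  m≰x rewrite scan-short x (ℕ.≰⇒> m≰x) | List.++-identityʳ (read R (a ∷ x))
                          | scan-▹-cons a (x ++ y) | local (a ∷ x) y m≤ =
        ⊆.++⁺ {as = List.map inj₁ (read R (a ∷ x))} ⊆-refl
          (subst (λ z → List.map inj₂ (scan R′ z) ⊆
              List.map inj₂ (read R′ (List.drop m (a ∷ x ++ y))) ++ scan S (x ++ y))
            (drop-exact m (a ∷ x) (ℕ.≤-antisym m≤ (ℕ.≰⇒> m≰x)))
            (scan-lag⊆step a (x ++ y) (scan-lag⊆ (x ++ y))))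
        where
        drop-exact : ∀ m (x : List A) → m ≡ length x → List.drop m (x ++ y) ≡ y
        drop-exact _ []      refl = refl
        drop-exact _ (_ ∷ x) refl = drop-exact _ x refl

      -- The cut is put at the end of the window that supplies the last left letter. The right
      -- letters are output later, by a reader that is then already beyond this cut.
      scan-▹⁻ : ∀ b v V w → List.map inj₁ (b ∷ v) ++ List.map inj₂ V ⊆ scan S w →
        ∃[ x ] ∃[ y ] (w ≡ x ++ y × b ∷ v ⊆ scan R x × V ⊆ scan R′ y)
      scan-▹⁻ b v V (a ∷ w) s
        with ⊆-split-inj₁ (b ∷ v) V (read R (a ∷ w)) (⊆-respʳ (scan-▹-cons a w) s)
      ... | p , c ∷ q , eq , p⊆ , q⊆
        with x , y , refl , q⊆x , V⊆y ← scan-▹⁻ c q V w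
          (⊆-skip-inj₂ {v = List.map inj₁ q ++ List.map inj₂ V} (read R′ (List.drop m (a ∷ w))) q⊆) =
        a ∷ x , y , refl ,
        ⊆-respˡ (≡.sym eq) (⊆.++⁺ (⊆-respʳ (local (a ∷ x) y (ℕ.m≤n⇒m≤1+n (width≤ x q⊆x))) p⊆) q⊆x) ,
        V⊆y
      ... | p , [] , eq , p⊆ , V⊆ = List.take m (a ∷ w) , List.drop m (a ∷ w) ,
        ≡.sym (List.take++drop≡id m (a ∷ w)) ,
        ⊆-trans v⊆ (⊆-trans (⊆-reflexive read-take) (read⊆scan R (List.take m (a ∷ w)))) ,
        ⊆-respˡ (rights-inj₂ V) (⊆-trans (rights-⊆ V⊆′) (rights-scan (a ∷ w)))
        where
        v⊆ : b ∷ v ⊆ read R (a ∷ w)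
        v⊆ = ⊆-respˡ (≡.sym (≡.trans eq (List.++-identityʳ p))) p⊆
        V⊆′ : List.map inj₂ V ⊆ scan S (a ∷ w)
        V⊆′ = ⊆-respʳ (≡.sym (scan-▹-cons a w)) (⊆.++⁺ˡ (List.map inj₁ (read R (a ∷ w))) V⊆)
        m≤w : m ≤ length (a ∷ w)
        m≤w = width≤ (a ∷ w) (⊆-trans v⊆ (read⊆scan R (a ∷ w)))
        read-take : read R (a ∷ w) ≡ read R (List.take m (a ∷ w))
        read-take = ≡.trans (cong (read R) (≡.sym (List.take++drop≡id m (a ∷ w))))
          (local (List.take m (a ∷ w)) (List.drop m (a ∷ w))
            (ℕ.≤-reflexive (≡.sym (≡.trans (List.length-take m (a ∷ w)) (ℕ.m≤n⇒m⊓n≡m m≤w)))))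

  open Test public using (⟦_⟧)

  Product : List Test → Language A
  Product []       = U
  Product (t ∷ ts) = ⟦ t ⟧ · Product ts

  record Scan (L : Language A) : Set₁ where
    field
      {Letter} : Set
      _≟_      : DecidableEquality Letter
      reader   : List (Atom Letter)
      word     : List Letter
      correct  : ∀ w → L w ⇔ word ⊆ scan reader w

  Product-scan : ∀ ts → Scan (Product ts)
  Product-scan [] = record
    { Letter = ⊥ ; _≟_ = λ () ; reader = [] ; word = [] ; correct = λ w → mk⇔ (λ _ → minimum _) (λ _ → tt) }
  Product-scan (t ∷ ts) = record
    { _≟_     = Sum.≡-dec t._≟_ s._≟_
    ; reader  = t.reader ▹[ t.width ] s.reader
    ; word    = List.map inj₁ v ++ List.map inj₂ s.word
    ; correct = λ w → mk⇔
        (λ { (x , y , refl , v⊆ , Dy) →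
          ⊆-trans (⊆.++⁺ (⊆.map⁺ inj₁ v⊆) (⊆.map⁺ inj₂ (Equivalence.to (s.correct y) Dy)))
            (t.scan-▹-++ s.reader x y (t.width≤ x v⊆)) })
        (λ p → let b ∷ v = t.pattern⁺ ; x , y , eq , v⊆ , V⊆ = t.scan-▹⁻ s.reader b v s.word w p in
          x , y , eq , v⊆ , Equivalence.from (s.correct y) V⊆)
    }
    where
    module t = Test t
    module s = Scan (Product-scan ts)
    v = List⁺.toList t.pattern⁺

  InPJ-Product : ∀ ts → InPJ (Product ts)
  InPJ-Product ts = InPJ-resp-≐ (λ w → word ⊆ scan reader w) (Product ts)
    ((λ {w} → Equivalence.from (correct w)) , (λ {w} → Equivalence.to (correct w)))
    (InPJ-scan _≟_ word reader)
    where open Scan (Product-scan ts)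

-- Factorisations of lists

module _ {B : Set} where

  -- Levi's lemma, with the second alternative strict so that it contradicts the minimality of a
  -- prefix.
  compare-splits : ∀ (x y : List B) {x′ y′} → x ++ x′ ≡ y ++ y′ →
    (∃[ z ] (y ≡ x ++ z × x′ ≡ z ++ y′)) ⊎ (∃[ b ] ∃[ z ] (x ≡ y ++ b ∷ z × y′ ≡ b ∷ z ++ x′))
  compare-splits []      y       eq = inj₁ (y , refl , eq)
  compare-splits (b ∷ x) []      eq = inj₂ (b , x , refl , ≡.sym eq)
  compare-splits (b ∷ x) (c ∷ y) eq with refl , eq′ ← List.∷-injective eq | compare-splits x y (List.∷-injectiveʳ eq)
  ... | inj₁ (z , refl , eq″)     = inj₁ (z , refl , eq″)
  ... | inj₂ (d , z , refl , eq″) = inj₂ (d , z , refl , eq″)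

  ⊆-split : ∀ {x : List B} y {z} → x ⊆ y ++ z → ∃[ p ] ∃[ q ] (x ≡ p ++ q × p ⊆ y × q ⊆ z)
  ⊆-split []      s          = [] , _ , refl , [] , s
  ⊆-split (b ∷ y) (_ ∷ʳ s)   with p , q , eq , p⊆ , q⊆ ← ⊆-split y s = p , q , eq , b ∷ʳ p⊆ , q⊆
  ⊆-split (b ∷ y) (refl ∷ s) with p , q , eq , p⊆ , q⊆ ← ⊆-split y s =
    b ∷ p , q , cong (b ∷_) eq , refl ∷ p⊆ , q⊆

  length-<-++-∷ : ∀ (x : List B) b z → length x < length (x ++ b ∷ z)
  length-<-++-∷ x b z = subst (length x <_) (≡.sym (List.length-++ x)) (ℕ.m<m+n (length x) (s≤s z≤n))

  ^ʷ-+ : ∀ (x : List B) m n → x ^ʷ (m + n) ≡ x ^ʷ m ++ x ^ʷ n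
  ^ʷ-+ x zero    n = refl
  ^ʷ-+ x (suc m) n = ≡.trans (cong (x ++_) (^ʷ-+ x m n)) (≡.sym (List.++-assoc x (x ^ʷ m) (x ^ʷ n)))

  -- If the cut after `a` splits a copy of `x` into `p` and `s`, then inserting `s ++ p` there
  -- completes one more copy, and `s ++ p` is a subword of `x ++ x`. This is why a sweep doubles a
  -- plain reading.
  ^ʷ-insert : ∀ (x : List B) n a {r} → x ^ʷ n ≡ a ++ r → ∃[ d ] (d ⊆ x ++ x × x ^ʷ suc n ≡ a ++ d ++ r)
  ^ʷ-insert x zero    []      refl = x , ⊆.++⁺ʳ x ⊆-refl , refl
  ^ʷ-insert x (suc n) a {r} eq with compare-splits x a eq
  ... | inj₁ (a′ , refl , eq′) with d , d⊆ , eq″ ← ^ʷ-insert x n a′ eq′ =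
    d , d⊆ , ≡.trans (cong (x ++_) eq″) (≡.sym (List.++-assoc x a′ (d ++ r)))
  ... | inj₂ (b , z , refl , refl) = b ∷ z ++ a ,
    ⊆.++⁺ (⊆.++⁺ˡ a ⊆-refl) (⊆.++⁺ʳ (b ∷ z) ⊆-refl) ,
    (begin
      (a ++ b ∷ z) ++ (a ++ b ∷ z) ++ (a ++ b ∷ z) ^ʷ n
        ≡⟨ List.++-assoc a (b ∷ z) _ ⟩
      a ++ b ∷ z ++ (a ++ b ∷ z) ++ (a ++ b ∷ z) ^ʷ n
        ≡⟨ cong (λ t → a ++ b ∷ z ++ t) (List.++-assoc a (b ∷ z) _) ⟩
      a ++ b ∷ z ++ a ++ b ∷ z ++ (a ++ b ∷ z) ^ʷ n
        ≡⟨ cong (a ++_) (List.++-assoc (b ∷ z) a _) ⟨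
      a ++ (b ∷ z ++ a) ++ b ∷ z ++ (a ++ b ∷ z) ^ʷ n ∎)
    where open ≡.≡-Reasoning

  -- A factor that avoids a letter of `x` contains no whole copy of `x`. Hence it meets at most two
  -- neighbouring copies, which is why a plain reading outputs each window twice.
  ^ʷ-factor : ∀ (x : List B) {j} → j ∈ x → ∀ n a b {c} → x ^ʷ n ≡ a ++ b ++ c → ¬ j ∈ b →
    ∃[ b₁ ] ∃[ b₂ ] (b ≡ b₁ ++ b₂ × b₁ ⊆ x × b₂ ⊆ x)
  ^ʷ-factor x j∈x zero    []      []      eq j∉b = [] , [] , refl , minimum x , minimum x
  ^ʷ-factor x j∈x (suc n) a       b       eq j∉b with compare-splits x a eq
  ... | inj₁ (a′ , refl , eq′) = ^ʷ-factor x j∈x n a′ b eq′ j∉b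
  ... | inj₂ (d , z , refl , eq′) with compare-splits (d ∷ z) b (≡.sym eq′)
  ...   | inj₂ (e , z′ , eq″ , _) = b , [] , ≡.sym (List.++-identityʳ b) ,
    subst (λ t → b ⊆ a ++ t) (≡.sym eq″) (⊆.++⁺ˡ a (⊆.++⁺ʳ _ ⊆-refl)) , minimum _
  ...   | inj₁ (b₂ , refl , eq″) = d ∷ z , b₂ , refl , ⊆.++⁺ˡ a ⊆-refl , prefix n b₂ (j∉b ∘ ∈-++⁺ʳ (d ∷ z)) eq″
    where
    prefix : ∀ n b₂ {c} → ¬ _ ∈ b₂ → (a ++ d ∷ z) ^ʷ n ≡ b₂ ++ c → b₂ ⊆ a ++ d ∷ z
    prefix zero    []  _    _  = minimum _
    prefix (suc n) b₂ j∉b₂ eq with compare-splits (a ++ d ∷ z) b₂ eq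
    ... | inj₁ (_ , refl , _)     = contradiction (∈-++⁺ˡ j∈x) j∉b₂
    ... | inj₂ (e , z′ , eq′ , _) = ⊆-respʳ (≡.sym eq′) (⊆.++⁺ʳ (e ∷ z′) ⊆-refl)

-- Reading windows

module _ {A : Set} where

  data Within {B : Set} (m : ℕ) : Atom {A} B → Set where
    within : ∀ p k f → p + suc k ≡ m → Within m (atom p (k ≤ᵇ_) f)

  readAtom-local : ∀ {B} p k (f : A → List B) x y → p + suc k ≤ length x →
    readAtom (atom p (k ≤ᵇ_) f) (x ++ y) ≡ readAtom (atom p (k ≤ᵇ_) f) x
  readAtom-local zero    k f []      y ()
  readAtom-local (suc p) k f []      y ()
  readAtom-local (suc p) k f (a ∷ x) y (s≤s le) = readAtom-local p k f x y le
  readAtom-local zero    k f (a ∷ x) y (s≤s k≤x)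
    rewrite Equivalence.to T-≡ (ℕ.≤⇒≤ᵇ k≤x)
          | Equivalence.to T-≡ (ℕ.≤⇒≤ᵇ (ℕ.≤-trans k≤x
              (ℕ.≤-trans (ℕ.m≤m+n _ (length y)) (ℕ.≤-reflexive (≡.sym (List.length-++ x {y})))))) = refl

  readAtom-short : ∀ {B} p k (f : A → List B) x → length x < p + suc k → readAtom (atom p (k ≤ᵇ_) f) x ≡ []
  readAtom-short p       k f []      _        = refl
  readAtom-short (suc p) k f (a ∷ x) (s≤s lt) = readAtom-short p k f x lt
  readAtom-short zero    k f (a ∷ x) (s≤s lt) with k ≤ᵇ length x in eq
  ... | true  = contradiction (ℕ.≤ᵇ⇒≤ k (length x) (subst T (≡.sym eq) tt)) (ℕ.<⇒≱ lt)
  ... | false = refl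

  read-local : ∀ {B m} {R : List (Atom B)} → All (Within m) R →
    ∀ x y → m ≤ length x → read R (x ++ y) ≡ read R x
  read-local []                              x y m≤x = refl
  read-local (within p k f refl ∷ R-within) x y m≤x =
    cong₂ _++_ (readAtom-local p k f x y m≤x) (read-local R-within x y m≤x)

  read-short : ∀ {B m} {R : List (Atom B)} → All (Within m) R → ∀ x → length x < m → read R x ≡ []
  read-short []                              x x<m = refl
  read-short (within p k f refl ∷ R-within) x x<m =
    cong₂ _++_ (readAtom-short p k f x x<m) (read-short R-within x x<m)

  read-++ : ∀ {B} (R S : List (Atom {A} B)) x → read (R ++ S) x ≡ read R x ++ read S x
  read-++ R S x = List.concatMap-++ (λ r → readAtom r x) R S

module Window {A : Set} (_≟_ : DecidableEquality A) where

  -- The window guard κ compares the number of letters of the window that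
  -- follow the one being read with the number of letters of the input that do.
  module Matching (κ : ℕ → ℕ → Bool) where

    remaining : ∀ (u : List A) → Fin (length u) → ℕ
    remaining u j = length u ∸ suc (toℕ j)

    offset+remaining : ∀ u j → toℕ j + suc (remaining u j) ≡ length u
    offset+remaining u j = ≡.trans (ℕ.+-suc (toℕ j) (remaining u j)) (ℕ.m+[n∸m]≡n (Fin.toℕ<n j))

    matches : ℕ → (ℕ → Bool) → A → List A → Bool
    matches _       g c []      = false
    matches zero    g c (a ∷ y) = g (length y) ∧ isYes (a ≟ c)
    matches (suc p) g c (_ ∷ y) = matches p g c y

    Match : ∀ u → List A → Fin (length u) → Set
    Match u y j = T (matches (toℕ j) (κ (remaining u j)) (List.lookup u j) y)

    match? : ∀ u y → Decidable (Match u y)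
    match? u y j = T? _

    windowAtom : ∀ u → Fin (length u) → Atom {A} (Fin (length u))
    windowAtom u j = atom (toℕ j) (κ (remaining u j)) λ a → if isYes (a ≟ List.lookup u j) then j ∷ [] else []

    window : ∀ u → List (Atom {A} (Fin (length u)))
    window u = List.map (windowAtom u) (List.allFin _)

    indices : ∀ (u : List A) → List (Fin (length u))
    indices u = List.allFin (length u)

    readAtom-matches : ∀ {B : Set} p g c (b : B) y →
      readAtom (atom p g (λ a → if isYes (a ≟ c) then b ∷ [] else [])) y ≡ (if matches p g c y then b ∷ [] else [])
    readAtom-matches zero    g c b []      = refl
    readAtom-matches (suc p) g c b []      = refl
    readAtom-matches (suc p) g c b (a ∷ y) = readAtom-matches p g c b y
    readAtom-matches zero    g c b (a ∷ y) with g (length y)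
    ... | true  = refl
    ... | false = refl

    read-window : ∀ u y → read (window u) y ≡ List.filter (match? u y) (indices u)
    read-window u y = go (indices u)
      where
      go : ∀ js → read (List.map (windowAtom u) js) y ≡ List.filter (match? u y) js
      go []       = refl
      go (j ∷ js) rewrite readAtom-matches (toℕ j) (κ (remaining u j)) (List.lookup u j) j y
        with matches (toℕ j) (κ (remaining u j)) (List.lookup u j) y
      ... | true  = cong (j ∷_) (go js)
      ... | false = go js

    Guarded : List A → List A → Set
    Guarded u z = ∀ j → T (κ (remaining u j) (remaining u j + length z))

    match-all⇒ : ∀ u y → (∀ j → Match u y j) → ∃[ z ] (y ≡ u ++ z × Guarded u z)
    match-all⇒ []      y       _ = y , refl , λ ()
    match-all⇒ (c ∷ u) []      m = contradiction (m zero) λ ()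
    match-all⇒ (c ∷ u) (a ∷ y) m
      with z , refl , g ← match-all⇒ u y (m ∘ suc)
         | κ-ok , a≟c ← Equivalence.to T-∧ (m zero) =
      z , cong (_∷ u ++ z) (toWitness {a? = a ≟ c} a≟c) ,
      λ { zero → subst (T ∘ κ (length u)) (List.length-++ u) κ-ok ; (suc j) → g j }

    match-all⇐ : ∀ u z → Guarded u z → ∀ j → Match u (u ++ z) j
    match-all⇐ (c ∷ u) z g zero = Equivalence.from T-∧
      (subst (T ∘ κ (length u)) (≡.sym (List.length-++ u)) (g zero) , fromWitness {a? = c ≟ c} refl)
    match-all⇐ (c ∷ u) z g (suc j) = match-all⇐ u z (g ∘ suc) j

    -- Every index that is output has matched, and `indices u` lists them all.
    indices⊆read⇒ : ∀ u y → indices u ⊆ read (window u) y → ∃[ z ] (y ≡ u ++ z × Guarded u z)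
    indices⊆read⇒ u y s = match-all⇒ u y λ j →
      All.lookup (⊆.All-resp-⊆ (⊆-respʳ (read-window u y) s) (All.all-filter (match? u y) (indices u))) (∈-allFin j)

    read-all : ∀ u z → Guarded u z → read (window u) (u ++ z) ≡ indices u
    read-all u z g = ≡.trans (read-window u (u ++ z))
      (List.filter-all (match? u (u ++ z)) {indices u} (All.tabulate λ {j} _ → match-all⇐ u z g j))

    matches⇒∈take : ∀ p g c y m → p < m → T (matches p g c y) → c ∷ [] ⊆ List.take m y
    matches⇒∈take zero g c (a ∷ y) (suc m) _ t
      with refl ← toWitness {a? = a ≟ c} (proj₂ (Equivalence.to T-∧ t)) = refl ∷ minimum _
    matches⇒∈take (suc p) g c (a ∷ y) (suc m) (s≤s p<m) t = a ∷ʳ matches⇒∈take p g c y m p<m t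

  -- With `_≤ᵇ_` a letter is read only if the whole window fits into the input.
  module Prefix where
    open Matching _≤ᵇ_ public

    guarded : ∀ u z → Guarded u z
    guarded u z j = ℕ.≤⇒≤ᵇ (ℕ.m≤m+n (remaining u j) (length z))

    window-within : ∀ u → All (Within (length u)) (window u)
    window-within u = All.map⁺ (All.tabulate λ {j} _ →
      within (toℕ j) (remaining u j) _ (offset+remaining u j))

    InPJ-startsWith : ∀ u → InPJ (｛ u ｝ · U)
    InPJ-startsWith u = InPJ-resp-≐ (λ w → indices u ⊆ read (window u) w) (｛ u ｝ · U)
      ( (λ {w} s → let z , eq , _ = indices⊆read⇒ u w s in u , z , eq , refl , tt)
      , (λ { (_ , z , refl , refl , _) → ⊆-reflexive (≡.sym (read-all u z (guarded u z))) }))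
      (InPJ-read Fin._≟_ (indices u) (window u))

  -- With `_≡ᵇ_` a letter is read only from the window that ends together with the input.
  module Suffix where
    open Matching _≡ᵇ_

    guarded : ∀ u → Guarded u []
    guarded u j = ℕ.≡⇒≡ᵇ _ _ (≡.sym (ℕ.+-identityʳ (remaining u j)))

    guarded⇒[] : ∀ c u z → Guarded (c ∷ u) z → z ≡ []
    guarded⇒[] c u []      g = refl
    guarded⇒[] c u (a ∷ z) g = contradiction (ℕ.≡ᵇ⇒≡ _ _ (g zero)) (ℕ.<⇒≢ (ℕ.m<m+n (length u) (s≤s z≤n)))

    matches-length : ∀ p k c y → T (matches p (k ≡ᵇ_) c y) → length y ≡ p + suc k
    matches-length zero    k c (a ∷ y) t = cong suc (≡.sym (ℕ.≡ᵇ⇒≡ k (length y) (proj₁ (Equivalence.to T-∧ t))))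
    matches-length (suc p) k c (a ∷ y) t = cong suc (matches-length p k c y t)

    read-elsewhere : ∀ u y → length y ≢ length u → read (window u) y ≡ []
    read-elsewhere u y y≢u = ≡.trans (read-window u y)
      (List.filter-none (match? u y) {indices u} (All.tabulate λ {j} _ t →
        y≢u (≡.trans (matches-length (toℕ j) (remaining u j) _ y t) (offset+remaining u j))))

    scan-shorter : ∀ u y → length y < length u → scan (window u) y ≡ []
    scan-shorter u []      _   = refl
    scan-shorter u (a ∷ y) y<u = cong₂ _++_ (read-elsewhere u (a ∷ y) (ℕ.<⇒≢ y<u))
      (scan-shorter u y (ℕ.<-trans (ℕ.n<1+n _) y<u))

    -- All windows are silent except the one starting at the suffix of the right length, so the scan
    -- reduces to a single reading.
    scan⇒suffix : ∀ c u w → indices (c ∷ u) ⊆ scan (window (c ∷ u)) w → ∃[ x ] w ≡ x ++ c ∷ u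
    scan⇒suffix c u (a ∷ w) s with length w ℕ.≟ length u
    ... | no  w≢u with x , eq ← scan⇒suffix c u w (⊆-respʳ (cong (_++ scan (window (c ∷ u)) w)
          (read-elsewhere (c ∷ u) (a ∷ w) (w≢u ∘ ℕ.suc-injective))) s) = a ∷ x , cong (a ∷_) eq
    ... | yes w≡u with z , eq , g ← indices⊆read⇒ (c ∷ u) (a ∷ w) (⊆-respʳ (≡.trans
          (cong (read (window (c ∷ u)) (a ∷ w) ++_) (scan-shorter (c ∷ u) w (s≤s (ℕ.≤-reflexive w≡u))))
          (List.++-identityʳ _)) s)
      with refl ← guarded⇒[] c u z g = [] , ≡.trans eq (List.++-identityʳ (c ∷ u))

    InPJ-endsWith : ∀ (u⁺ : List⁺ A) → InPJ (U · ｛ List⁺.toList u⁺ ｝)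
    InPJ-endsWith (c ∷ v) = InPJ-resp-≐ (λ w → indices u ⊆ scan (window u) w) (U · ｛ u ｝)
      ( (λ {w} s → let x , eq = scan⇒suffix c v w s in x , u , eq , tt , refl)
      , (λ { (x , _ , refl , _ , refl) → ⊆-trans (⊆-reflexive (≡.sym (≡.trans
          (cong (read (window u)) (≡.sym (List.++-identityʳ u))) (read-all u [] (guarded u)))))
          (⊆-trans (read⊆scan (window u) u) (scan-++ʳ (window u) x u)) }))
      (InPJ-scan Fin._≟_ (indices u) (window u))
      where u = c ∷ v

-- Plain readings and sweeps for one word

module Sweep {A : Set} (_≟_ : DecidableEquality A) (u⁺ : List⁺ A) where

  open Window _≟_
  open Prefix

  u : List A
  u = List⁺.toList u⁺

  m : ℕ
  m = length u

  J : List (Fin m)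
  J = indices u

  j₀ : Fin m
  j₀ = zero

  js : List (Fin m)
  js = List.tabulate suc

  factor : Language A
  factor = U · ｛ u ｝ · U

  plainReader sweepReader : List (Atom {A} (Fin m))
  plainReader = window u ++ window u
  sweepReader = plainReader ++ plainReader

  powerTest : (R : List (Atom {A} (Fin m))) → All (Within m) R → ℕ → Test {A}
  powerTest R R-within t = record
    { _≟_      = Fin._≟_
    ; width    = m
    ; reader   = R
    ; pattern⁺ = j₀ ∷ (js ++ J ^ʷ t)
    ; local    = read-local R-within
    ; short    = read-short R-within
    }

  plain-within : All (Within m) plainReader
  plain-within = All.++⁺ (window-within u) (window-within u)

  -- Their patterns are the powers J ^ʷ suc t.
  plain sweep : ℕ → Test {A}
  plain = powerTest plainReader plain-within
  sweep = powerTest sweepReader (All.++⁺ plain-within plain-within)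

  letters : List (Atom {A} A)
  letters = atom 0 (0 ≤ᵇ_) (λ a → a ∷ []) ∷ []

  scan-letters : ∀ w → scan letters w ≡ w
  scan-letters []      = refl
  scan-letters (a ∷ w) = cong (a ∷_) (scan-letters w)

  -- Its pattern is u ^ʷ suc l, so that the pattern is never empty.
  subword : ℕ → Test {A}
  subword l = record
    { _≟_      = _≟_
    ; width    = 1
    ; reader   = letters
    ; pattern⁺ = List⁺.head u⁺ ∷ (List⁺.tail u⁺ ++ u ^ʷ l)
    ; local    = read-local (within 0 0 _ refl ∷ [])
    ; short    = read-short (within 0 0 _ refl ∷ [])
    }

  read-plain : ∀ y → read plainReader y ≡ read (window u) y ++ read (window u) y
  read-plain y = read-++ (window u) (window u) y

  read-sweep : ∀ y → read sweepReader y ≡ read plainReader y ++ read plainReader y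
  read-sweep y = read-++ plainReader plainReader y

  plain⊆sweep-read : ∀ y → read plainReader y ⊆ read sweepReader y
  plain⊆sweep-read y = ⊆-respʳ (≡.sym (read-sweep y)) (⊆.++⁺ʳ (read plainReader y) ⊆-refl)

  plain⊆sweep : ∀ x → scan plainReader x ⊆ scan sweepReader x
  plain⊆sweep []      = []
  plain⊆sweep (a ∷ x) = ⊆.++⁺ (plain⊆sweep-read (a ∷ x)) (plain⊆sweep x)

  -- The plain match is followed up to the window that contains `u`, with `a` the part of the power
  -- consumed before. There the sweep outputs `J` four times: two copies hold the word from
  -- `^ʷ-insert`, and the other two continue the plain match.
  insert-factor : ∀ t x₁ x₂ a r → J ^ʷ t ≡ a ++ r → r ⊆ scan plainReader (x₁ ++ u ++ x₂) →
    ∃[ r′ ] (J ^ʷ suc t ≡ a ++ r′ × r′ ⊆ scan sweepReader (x₁ ++ u ++ x₂))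
  insert-factor t [] x₂ a r eq s
    with d , d⊆ , eq′ ← ^ʷ-insert J t a eq
       | p , q , refl , p⊆ , q⊆ ← ⊆-split (read plainReader (u ++ x₂)) s =
    d ++ p ++ q , eq′ , ⊆-respˡ (List.++-assoc d p q) (⊆.++⁺
      (⊆-respʳ (≡.sym (≡.trans (read-sweep (u ++ x₂)) (cong (_++ read plainReader (u ++ x₂)) full)))
        (⊆.++⁺ d⊆ p⊆))
      (⊆-trans q⊆ (plain⊆sweep (List⁺.tail u⁺ ++ x₂))))
    where
    full : read plainReader (u ++ x₂) ≡ J ++ J
    full = ≡.trans (read-plain (u ++ x₂)) (cong₂ _++_ e e)
      where e = read-all u x₂ (guarded u x₂)
  insert-factor t (b ∷ x₁) x₂ a r eq s
    with p , q , refl , p⊆ , q⊆ ← ⊆-split (read plainReader (b ∷ x₁ ++ u ++ x₂)) s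
    with r′ , eq′ , r′⊆ ← insert-factor t x₁ x₂ (a ++ p) q (≡.trans eq (≡.sym (List.++-assoc a p q))) q⊆ =
    p ++ r′ , ≡.trans eq′ (List.++-assoc a p r′) , ⊆.++⁺ (⊆-trans p⊆ (plain⊆sweep-read (b ∷ x₁ ++ u ++ x₂))) r′⊆

  factor⇒sweep-zero : ∀ x → factor x → ⟦ sweep 0 ⟧ x
  factor⇒sweep-zero x (x₁ , _ , refl , _ , _ , x₂ , refl , refl , _)
    with r′ , refl , r′⊆ ← insert-factor 0 x₁ x₂ [] [] refl (minimum _) = r′⊆

  factor⇒sweep-suc : ∀ t x → factor x → ⟦ plain t ⟧ x → ⟦ sweep (suc t) ⟧ x
  factor⇒sweep-suc t x (x₁ , _ , refl , _ , _ , x₂ , refl , refl , _) s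
    with r′ , refl , r′⊆ ← insert-factor (suc t) x₁ x₂ [] (J ^ʷ suc t) refl s = r′⊆

  prefix? : ∀ y → (∃[ z ] y ≡ u ++ z) ⊎ (∃[ j ] ¬ Match u y j)
  prefix? y with Fin.all? (match? u y)
  ... | yes all = let z , eq , _ = match-all⇒ u y all in inj₁ (z , eq)
  ... | no ¬all = inj₂ (Fin.¬∀⟶∃¬ _ _ (match? u y) ¬all)

  module _ (y : List A) where

    ∈-plain⇒match : ∀ {j} → j ∈ read plainReader y → Match u y j
    ∈-plain⇒match j∈ with ∈-++⁻ (read (window u) y) (subst (_ ∈_) (read-plain y) j∈)
    ... | inj₁ i = proj₂ (∈-filter⁻ (match? u y) {xs = J} (subst (_ ∈_) (read-window u y) i))
    ... | inj₂ i = proj₂ (∈-filter⁻ (match? u y) {xs = J} (subst (_ ∈_) (read-window u y) i))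

    ∈-sweep⇒match : ∀ {j} → j ∈ read sweepReader y → Match u y j
    ∈-sweep⇒match j∈ with ∈-++⁻ (read plainReader y) (subst (_ ∈_) (read-sweep y) j∈)
    ... | inj₁ i = ∈-plain⇒match i
    ... | inj₂ i = ∈-plain⇒match i

    ⊆J⇒⊆window : ∀ b → b ⊆ J → All (Match u y) b → b ⊆ read (window u) y
    ⊆J⇒⊆window b b⊆J matched = ⊆-respʳ (≡.sym (read-window u y))
      (⊆-respˡ (List.filter-all (match? u y) matched) (⊆.filter⁺ (match? u y) (match? u y) (λ { refl → id }) b⊆J))

    -- What a window contributes to the match avoids its missing index `j`. By `^ʷ-factor` it splits
    -- into two subwords of `J`, one for each of the two copies in the plain reading.
    sweep⇒plain-read : ∀ t a b {c j} → J ^ʷ t ≡ a ++ b ++ c → ¬ Match u y j →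
      b ⊆ read sweepReader y → b ⊆ read plainReader y
    sweep⇒plain-read t a b {c} {j} eq ¬match s
      with b₁ , b₂ , refl , b₁⊆ , b₂⊆ ← ^ʷ-factor J (∈-allFin j) t a b eq
             (λ j∈b → ¬match (∈-sweep⇒match (Sublist.lookup s j∈b))) =
      ⊆-respʳ (≡.sym (read-plain y)) (⊆.++⁺
        (⊆J⇒⊆window b₁ b₁⊆ (All.tabulate λ i∈ → ∈-sweep⇒match (Sublist.lookup s (∈-++⁺ˡ i∈))))
        (⊆J⇒⊆window b₂ b₂⊆ (All.tabulate λ i∈ → ∈-sweep⇒match (Sublist.lookup s (∈-++⁺ʳ b₁ i∈)))))

  -- The match is cut window by window. The contexts `a` and `c` keep every piece a factor of
  -- `J ^ʷ t`, as `sweep⇒plain-read` requires.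
  sweep⇒plain-factor : ∀ t x a b {c} → J ^ʷ t ≡ a ++ b ++ c → b ⊆ scan sweepReader x →
    factor x ⊎ b ⊆ scan plainReader x
  sweep⇒plain-factor t []      a b eq s = inj₂ s
  sweep⇒plain-factor t (d ∷ x) a b {c} eq s with prefix? (d ∷ x)
  ... | inj₁ (z , eq′) = inj₁ ([] , _ , refl , tt , u , z , eq′ , refl , tt)
  ... | inj₂ (j , ¬match) with p , q , refl , p⊆ , q⊆ ← ⊆-split (read sweepReader (d ∷ x)) s
    with sweep⇒plain-factor t x (a ++ p) q (≡.trans eq
           (≡.trans (cong (a ++_) (List.++-assoc p q c)) (≡.sym (List.++-assoc a p (q ++ c))))) q⊆
  ...   | inj₁ (x₁ , x₂ , refl , f) = inj₁ (d ∷ x₁ , x₂ , refl , f)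
  ...   | inj₂ q⊆′ = inj₂ (⊆.++⁺ (sweep⇒plain-read (d ∷ x) t a p {j = j}
      (≡.trans eq (cong (a ++_) (List.++-assoc p q c))) ¬match p⊆) q⊆′)

  sweep⇒factor⊎plain : ∀ t x → ⟦ sweep t ⟧ x → factor x ⊎ ⟦ plain t ⟧ x
  sweep⇒factor⊎plain t x = sweep⇒plain-factor (suc t) x [] (J ^ʷ suc t) (≡.sym (List.++-identityʳ _))

  length-read-plain : ∀ y → length (read plainReader y) ≤ length (J ++ J)
  length-read-plain y rewrite read-plain y | read-window u y =
    ⊆.length-mono-≤ (⊆.++⁺ (⊆.filter-⊆ (match? u y) J) (⊆.filter-⊆ (match? u y) J))

  -- The first window outputs at most as many letters as `J ++ J`, so whatever follows two copies of
  -- `J` is found after it.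
  skip-window : ∀ x {q} → (J ++ J) ++ q ⊆ scan plainReader x → q ⊆ scan plainReader (List.drop 1 x)
  skip-window [] ()
  skip-window (a ∷ x) {q} s with p , r , eq , p⊆ , r⊆ ← ⊆-split (read plainReader (a ∷ x)) s
    with compare-splits (J ++ J) p eq
  ... | inj₁ ([]    , refl , refl) = r⊆
  ... | inj₁ (b ∷ z , refl , refl) = contradiction
    (ℕ.≤-trans (⊆.length-mono-≤ p⊆) (length-read-plain (a ∷ x)))
    (ℕ.<⇒≱ (length-<-++-∷ (J ++ J) b z))
  ... | inj₂ (b , z , _ , refl) = ⊆-trans (⊆.++⁺ˡ (b ∷ z) ⊆-refl) r⊆

  skip-windows : ∀ k x {q} → J ^ʷ (k + k) ++ q ⊆ scan plainReader x → q ⊆ scan plainReader (List.drop k x)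
  skip-windows zero    x       s = s
  skip-windows (suc k) []      s rewrite ℕ.+-suc k k with () ← s
  skip-windows (suc k) (a ∷ x) {q} s rewrite ℕ.+-suc k k =
    skip-windows k x (skip-window (a ∷ x) (⊆-respˡ reassociate s))
    where
    reassociate : (J ++ J ++ J ^ʷ (k + k)) ++ q ≡ (J ++ J) ++ J ^ʷ (k + k) ++ q
    reassociate = ≡.trans (cong (_++ q) (≡.sym (List.++-assoc J J (J ^ʷ (k + k)))))
      (List.++-assoc (J ++ J) (J ^ʷ (k + k)) q)

  find-match : ∀ j {q} x → j ∷ q ⊆ scan plainReader x →
    ∃[ x₁ ] ∃[ x₂ ] (x ≡ x₁ ++ x₂ × Match u x₂ j × q ⊆ scan plainReader x₂)
  find-match j (a ∷ x) s with ⊆-split (read plainReader (a ∷ x)) s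
  ... | []    , _ , refl , _  , q⊆ with x₁ , x₂ , refl , match , s′ ← find-match j x q⊆ =
    a ∷ x₁ , x₂ , refl , match , s′
  ... | _ ∷ p , q , refl , p⊆ , _  =
    [] , a ∷ x , refl , ∈-plain⇒match (a ∷ x) (Sublist.lookup p⊆ (here refl)) , ⊆.∷ˡ⁻ s

  period : ℕ
  period = suc (m + m)

  -- A period spells one letter of g with its first copy of J. A window outputs at most two copies,
  -- so the other m + m copies can only be read after the m windows that overlap this letter.
  spell : ∀ g x → J ^ʷ (length g * period) ⊆ scan plainReader x → List.map (List.lookup u) g ⊆ x
  spell []      x s = minimum x
  spell (j ∷ g) x s
    with x₁ , x₂ , refl , match , s′ ← find-match j x (⊆-trans
      (⊆.++⁺ (from∈ (∈-allFin j)) (⊆-reflexive (≡.sym (^ʷ-+ J (m + m) (length g * period))))) s) =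
    ⊆.++⁺ˡ x₁ (⊆-respʳ (List.take++drop≡id m x₂) (⊆.++⁺
      (matches⇒∈take (toℕ j) _ _ x₂ m (Fin.toℕ<n j) match)
      (spell g (List.drop m x₂) (skip-windows m x₂ s′))))

  map-lookup-power : ∀ l → List.map (List.lookup u) (J ^ʷ l) ≡ u ^ʷ l
  map-lookup-power zero    = refl
  map-lookup-power (suc l) = ≡.trans (List.map-++ (List.lookup u) J (J ^ʷ l))
    (cong₂ _++_ (≡.trans (List.map-tabulate id (List.lookup u)) (List.tabulate-lookup u)) (map-lookup-power l))

  -- One `period` for each letter of `u ^ʷ suc l`, which `J ^ʷ suc l` spells index by index. The
  -- pattern of `plain (cap l)` has one further copy of `J`, which `plain⇒subword` discards.
  cap : ℕ → ℕ
  cap l = length (J ^ʷ suc l) * period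

  plain⇒subword : ∀ l x → ⟦ plain (cap l) ⟧ x → ⟦ subword l ⟧ x
  plain⇒subword l x s = ⊆-respʳ (≡.sym (scan-letters x)) (⊆-respˡ (map-lookup-power (suc l))
    (spell (J ^ʷ suc l) x (⊆-trans (⊆.++⁺ˡ J ⊆-refl) s)))

-- Shortest prefixes

module _ {A : Set} where

  shortest : (P : List A → List A → Set) → (∀ x y → Dec (P x y)) → ∀ w →
    (∃[ x ] ∃[ y ] (w ≡ x ++ y × P x y × (∀ x′ y′ → w ≡ x′ ++ y′ → P x′ y′ → length x ≤ length x′))) ⊎
    (∀ x y → w ≡ x ++ y → ¬ P x y)
  shortest P P? w with P? [] w
  ... | yes p = inj₁ ([] , w , refl , p , λ _ _ _ _ → z≤n)
  shortest P P? [] | no ¬p = inj₂ λ { [] [] refl → ¬p }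
  shortest P P? (a ∷ w) | no ¬p with shortest (P ∘ (a ∷_)) (P? ∘ (a ∷_)) w
  ... | inj₂ never = inj₂ λ { [] _ refl → ¬p ; (_ ∷ x) y refl → never x y refl }
  ... | inj₁ (x , y , refl , p , least) = inj₁ (a ∷ x , y , refl , p , λ
    { [] _ refl p′ → contradiction p′ ¬p
    ; (_ ∷ x′) y′ eq p′ → least′ x′ y′ eq p′ })
    where
    least′ : ∀ {b} x′ y′ → a ∷ x ++ y ≡ b ∷ x′ ++ y′ → P (b ∷ x′) y′ → suc (length x) ≤ suc (length x′)
    least′ x′ y′ eq p′ with refl ← List.∷-injectiveˡ eq = s≤s (least x′ y′ (List.∷-injectiveʳ eq) p′)

  ·-dec : ∀ {K L : Language A} → Decidable K → Decidable L → Decidable (K · L)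
  ·-dec {K} {L} K? L? w with shortest (λ x y → K x × L y) (λ x y → K? x ×-dec L? y) w
  ... | inj₁ (x , y , eq , Kx , Ly) = yes (x , y , eq , proj₁ Kx , proj₂ Kx)
  ... | inj₂ never = no λ (x , y , eq , p) → never x y eq p

  -- `Q` is followed upwards from 0 to its first failure or to the bound. Later arguments need just
  -- the failure at the successor.
  last-true : ∀ N (Q : ℕ → Set) → (∀ r → Dec (Q r)) → Q 0 →
    Σ[ r ∈ Fin (suc N) ] (Q (toℕ r) × (toℕ r ≡ N ⊎ ¬ Q (suc (toℕ r))))
  last-true zero    Q Q? q = zero , q , inj₁ refl
  last-true (suc N) Q Q? q with Q? 1
  ... | no ¬q = zero , q , inj₂ ¬q
  ... | yes q₁ with last-true N (Q ∘ suc) (Q? ∘ suc) q₁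
  ...   | r , qr , inj₁ eq = suc r , qr , inj₁ (cong suc eq)
  ...   | r , qr , inj₂ ¬q = suc r , qr , inj₂ ¬q

  -- What the argument on products needs to know about one word; windows no longer appear. The test
  -- `large` stands for the presence of the threshold power as a subword.
  record Block : Set₁ where
    field
      factor  : Language A
      factor? : Decidable factor
      factor-++ˡ : ∀ x y → factor x → factor (x ++ y)
      factor-++ʳ : ∀ x y → factor y → factor (x ++ y)
      large   : Test {A}
      plain   : ℕ → Test {A}
      sweep   : ℕ → Test {A}
      cap     : ℕ
      factor⇒sweep-zero : ∀ x → factor x → ⟦ sweep 0 ⟧ x
      factor⇒sweep-suc  : ∀ t x → factor x → ⟦ plain t ⟧ x → ⟦ sweep (suc t) ⟧ x
      sweep⇒factor⊎plain : ∀ t x → ⟦ sweep t ⟧ x → factor x ⊎ ⟦ plain t ⟧ x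
      plain⇒large        : ∀ x → ⟦ plain cap ⟧ x → ⟦ large ⟧ x

    target : Language A
    target = factor ∪ ⟦ large ⟧

    target? : Decidable target
    target? x = factor? x ⊎-dec Test.⟦⟧? large x

    target-++ˡ : ∀ x y → target x → target (x ++ y)
    target-++ˡ x y (inj₁ f) = inj₁ (factor-++ˡ x y f)
    target-++ˡ x y (inj₂ l) = inj₂ (Test.⟦⟧-++ˡ large x y l)

    target-++ʳ : ∀ x y → target y → target (x ++ y)
    target-++ʳ x y (inj₁ f) = inj₁ (factor-++ʳ x y f)
    target-++ʳ x y (inj₂ l) = inj₂ (Test.⟦⟧-++ʳ large x y l)

  open Block

  -- Products of blocks

  Target : List Block → Language A
  Target []       = U
  Target (b ∷ bs) = target b · Target bs

  Target? : ∀ bs → Decidable (Target bs)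
  Target? []       w = yes tt
  Target? (b ∷ bs) = ·-dec {target b} {Target bs} (target? b) (Target? bs)

  Target-++ʳ : ∀ bs z y → Target bs y → Target bs (z ++ y)
  Target-++ʳ []       z y _ = tt
  Target-++ʳ (b ∷ bs) z _ (x₁ , x₂ , refl , t , ts) =
    z ++ x₁ , x₂ , ≡.sym (List.++-assoc z x₁ x₂) , target-++ʳ b z x₁ t , ts

  Product-++ʳ : ∀ (ts : List (Test {A})) z y → Product ts y → Product ts (z ++ y)
  Product-++ʳ []       z y _ = tt
  Product-++ʳ (t ∷ ts) z _ (x₁ , x₂ , refl , p , ps) =
    z ++ x₁ , x₂ , ≡.sym (List.++-assoc z x₁ x₂) , Test.⟦⟧-++ʳ t z x₁ p , ps

  -- Exponents stop at `cap b`, where the plain test already implies `large b` and the choice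
  -- `nothing` becomes available.
  Choice : List Block → Set
  Choice []       = ⊤
  Choice (b ∷ bs) = Maybe (Fin (suc (cap b))) × Choice bs

  tests : ∀ bs → Choice bs → List (Test {A})
  tests []       _            = []
  tests (b ∷ bs) (nothing , c) = large b ∷ tests bs c
  tests (b ∷ bs) (just r  , c) = sweep b (toℕ r) ∷ tests bs c

  -- Each demotion replaces one sweeping test by the corresponding plain one.
  demotions : ∀ bs → Choice bs → List (List (Test {A}))
  demotions []       _            = []
  demotions (b ∷ bs) (nothing , c) = List.map (large b ∷_) (demotions bs c)
  demotions (b ∷ bs) (just r  , c) =
    (plain b (toℕ r) ∷ tests bs c) ∷ List.map (sweep b (toℕ r) ∷_) (demotions bs c)

  Avoids : List (List (Test {A})) → Language A
  Avoids = List.foldr (λ ts K → ∁ (Product ts) ∩ K) U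

  Avoids-map⁻ : ∀ f {w y} tss → (∀ ts → Product ts y → Product (f ts) w) → Avoids (List.map f tss) w → Avoids tss y
  Avoids-map⁻ f []         p _        = tt
  Avoids-map⁻ f (ts ∷ tss) p (a , as) = a ∘ p ts , Avoids-map⁻ f tss p as

  Avoids-map⁺ : ∀ f {w y} tss → (∀ ts → Product (f ts) w → Product ts y) → Avoids tss y → Avoids (List.map f tss) w
  Avoids-map⁺ f []         p _        = tt
  Avoids-map⁺ f (ts ∷ tss) p (a , as) = a ∘ p ts , Avoids-map⁺ f tss p as

  Avoids-suffix : ∀ tss z y → Avoids tss (z ++ y) → Avoids tss y
  Avoids-suffix []         z y _        = tt
  Avoids-suffix (ts ∷ tss) z y (a , as) = a ∘ Product-++ʳ ts z y , Avoids-suffix tss z y as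

  -- A sweep passed without the factor is passed by the plain reading too, and this would satisfy
  -- the demotion of that sweep. The remainder avoids the demotions of the tail, since the first
  -- test in front of one gives a demotion for the whole input.
  sound : ∀ bs c w → Product (tests bs c) w → Avoids (demotions bs c) w → Target bs w
  sound []       c             w _ _ = tt
  sound (b ∷ bs) (nothing , c) w (x , y , refl , l , p) a =
    x , y , refl , inj₂ l , sound bs c y p (Avoids-map⁻ (large b ∷_) (demotions bs c) (λ ts q → x , y , refl , l , q) a)
  sound (b ∷ bs) (just r , c) w (x , y , refl , s , p) (¬plain , a) with sweep⇒factor⊎plain b (toℕ r) x s
  ... | inj₁ f = x , y , refl , inj₁ f , sound bs c y p
    (Avoids-map⁻ (sweep b (toℕ r) ∷_) (demotions bs c) (λ ts q → x , y , refl , s , q) a)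
  ... | inj₂ q = contradiction (x , y , refl , q , p) ¬plain

  complete : ∀ bs w → Target bs w → ∃[ c ] (Product (tests bs c) w × Avoids (demotions bs c) w)
  complete []       w _ = tt , tt , tt
  complete (b ∷ bs) w (x₀ , y₀ , eq₀ , t₀ , T₀)
    with shortest (λ x y → ⟦ large b ⟧ x × Target bs y) (λ x y → Test.⟦⟧? (large b) x ×-dec Target? bs y) w
  ... | inj₁ (x , y , refl , (l , Ty) , least)
    with c , p , a ← complete bs y Ty =
    (nothing , c) , (x , y , refl , l , p) , Avoids-map⁺ (large b ∷_) (demotions bs c) later a
    where
    -- A shorter prefix passing `large b` would also leave a remainder in `Target bs`, against
    -- minimality. So any other cut lies at or after `x`, and its remainder is a suffix of `y`.
    later : ∀ ts → Product (large b ∷ ts) (x ++ y) → Product ts y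
    later ts (x′ , y′ , eq , l′ , q) with compare-splits x x′ eq
    ... | inj₁ (z , refl , refl)     = Product-++ʳ ts z y′ q
    ... | inj₂ (d , z , refl , refl) = contradiction
      (least x′ y′ eq (l′ , Target-++ʳ bs (d ∷ z) y Ty))
      (ℕ.<⇒≱ (length-<-++-∷ x′ d z))
  ... | inj₂ no-large
    -- The search can start at exponent 0: as `no-large` excludes the other alternative, the given
    -- prefix contains the factor, and one factor suffices for `sweep b 0`.
    with r , some , maximal ← last-true (cap b) (λ r → ((factor b ∩ ⟦ sweep b r ⟧) · Target bs) w)
           (λ r → ·-dec {factor b ∩ ⟦ sweep b r ⟧} {Target bs}
             (λ x → factor? b x ×-dec Test.⟦⟧? (sweep b r) x) (Target? bs) w)
           (x₀ , y₀ , eq₀ , ([ (λ f → f , factor⇒sweep-zero b x₀ f)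
                             , (λ l → contradiction (l , T₀) (no-large x₀ y₀ eq₀)) ]′ t₀) , T₀)
    with shortest (λ x y → (factor b ∩ ⟦ sweep b (toℕ r) ⟧) x × Target bs y)
           (λ x y → (factor? b x ×-dec Test.⟦⟧? (sweep b (toℕ r)) x) ×-dec Target? bs y) w
  ... | inj₂ never = contradiction (proj₂ (proj₂ (proj₂ some))) (never _ _ (proj₁ (proj₂ (proj₂ some))))
  ... | inj₁ (x , y , refl , ((f , s) , Ty) , least)
    with c , p , a ← complete bs y Ty =
    (just r , c) , (x , y , refl , s , p) , not-plain , Avoids-map⁺ (sweep b (toℕ r) ∷_) (demotions bs c) later a
    where
    t = toℕ r

    -- A prefix with both the factor and the plain test would allow a larger count.
    factor∧plain⇒¬Target : ∀ x′ y′ → x ++ y ≡ x′ ++ y′ → factor b x′ → ⟦ plain b t ⟧ x′ → ¬ Target bs y′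
    factor∧plain⇒¬Target x′ y′ eq f′ q T′ =
      [ (λ t≡cap → no-large x′ y′ eq (plain⇒large b x′ (subst (λ k → ⟦ plain b k ⟧ x′) t≡cap q) , T′))
      , (λ ¬more → ¬more (x′ , y′ , eq , (f′ , factor⇒sweep-suc b t x′ f′ q) , T′))
      ]′ maximal

    -- The plain test would persist from `x′` to `x`, which has the factor and leaves `y` in
    -- `Target bs`.
    ¬plain-x : ∀ x′ z → x ≡ x′ ++ z → ¬ ⟦ plain b t ⟧ x′
    ¬plain-x x′ z eq q = factor∧plain⇒¬Target x y refl f
      (subst ⟦ plain b t ⟧ (≡.sym eq) (Test.⟦⟧-++ˡ (plain b t) x′ z q)) Ty

    not-plain : ¬ Product (plain b t ∷ tests bs c) (x ++ y)
    not-plain (x′ , y′ , eq , q , p′) with compare-splits x x′ eq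
    ... | inj₂ (d , z , eq′ , _) = ¬plain-x x′ (d ∷ z) eq′ q
    -- The longer prefix inherits the factor from `x`. Its remainder, a suffix of `y`, still avoids
    -- the demotions of the tail, so soundness puts it into `Target bs`.
    ... | inj₁ (z , refl , refl) = factor∧plain⇒¬Target (x ++ z) y′ eq (factor-++ˡ b x z f) q
      (sound bs c y′ p′ (Avoids-suffix (demotions bs c) z y′ a))

    later : ∀ ts → Product (sweep b t ∷ ts) (x ++ y) → Product ts y
    later ts (x′ , y′ , eq , s′ , q) with compare-splits x x′ eq
    ... | inj₁ (z , refl , refl) = Product-++ʳ ts z y′ q
    -- A prefix shorter than `x` that passes the sweep either passes the plain test, which is
    -- excluded, or contains the factor, against the choice of `x` as shortest.
    ... | inj₂ (d , z , eq′ , eq″) with sweep⇒factor⊎plain b t x′ s′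
    ...   | inj₂ q′ = contradiction q′ (¬plain-x x′ (d ∷ z) eq′)
    ...   | inj₁ f′ = contradiction
      (least x′ y′ eq ((f′ , s′) , subst (Target bs) (≡.sym eq″) (Target-++ʳ bs (d ∷ z) y Ty)))
      (ℕ.<⇒≱ (subst (λ v → length x′ < length v) (≡.sym eq′) (length-<-++-∷ x′ d z)))

  InPJ-⋃-Choice : ∀ bs (Q : Choice bs → Language A) → (∀ c → InPJ (Q c)) → InPJ (λ w → ∃[ c ] Q c w)
  InPJ-⋃-Choice []       Q Q∈ = InPJ-resp-≐ (Q tt) (λ w → ∃[ c ] Q c w) ((tt ,_) , proj₂) (Q∈ tt)
  InPJ-⋃-Choice (b ∷ bs) Q Q∈ = InPJ-resp-≐
    ((λ w → ∃[ c ] Q (nothing , c) w) ∪ (λ w → ∃[ r ] ∃[ c ] Q (just r , c) w)) (λ w → ∃[ c ] Q c w)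
    ( [ (λ (c , q) → _ , q) , (λ (r , c , q) → _ , q) ]′
    , (λ { ((nothing , c) , q) → inj₁ (c , q) ; ((just r , c) , q) → inj₂ (r , c , q) }))
    (InPJ-∪ (λ w → ∃[ c ] Q (nothing , c) w) (λ w → ∃[ r ] ∃[ c ] Q (just r , c) w)
      (InPJ-⋃-Choice bs (λ c → Q (nothing , c)) (λ c → Q∈ (nothing , c)))
      (InPJ-⋃-Fin (λ r w → ∃[ c ] Q (just r , c) w) λ r →
        InPJ-⋃-Choice bs (λ c → Q (just r , c)) (λ c → Q∈ (just r , c))))

  InPJ-Target : ∀ bs → InPJ (Target bs)
  InPJ-Target bs = InPJ-resp-≐ (λ w → ∃[ c ] Accepts c w) (Target bs)
    ((λ {w} (c , p , a) → sound bs c w p a) , (λ {w} → complete bs w))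
    (InPJ-⋃-Choice bs Accepts λ c → InPJ-∩ (Product (tests bs c)) (Avoids (demotions bs c))
      (InPJ-Product (tests bs c))
      (InPJ-⋂ (λ ts → ∁ (Product ts)) (demotions bs c) λ ts → InPJ-∁ (Product ts) (InPJ-Product ts)))
    where
    Accepts : Choice bs → Language A
    Accepts c = Product (tests bs c) ∩ Avoids (demotions bs c)

-- Threshold dot-depth one languages

module _ {A : Set} (_≟_ : DecidableEquality A) where

  sweepBlock : ℕ → List⁺ A → Block
  sweepBlock l u⁺ = record
    { factor     = S.factor
    ; factor?    = ·-dec {K = U} (λ _ → yes tt) (·-dec {K = ｛ S.u ｝} {L = U} (List.≡-dec _≟_ S.u) (λ _ → yes tt))
    ; factor-++ˡ = λ { _ y (x₁ , _ , refl , _ , _ , x₂ , refl , refl , _) →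
        x₁ , S.u ++ (x₂ ++ y) , ≡.trans (List.++-assoc x₁ (S.u ++ x₂) y) (cong (x₁ ++_) (List.++-assoc S.u x₂ y)) ,
        tt , S.u , x₂ ++ y , refl , refl , tt }
    ; factor-++ʳ = λ { x _ (x₁ , x₂ , refl , _ , f) → x ++ x₁ , x₂ , ≡.sym (List.++-assoc x x₁ x₂) , tt , f }
    ; large      = S.subword l
    ; plain      = S.plain
    ; sweep      = S.sweep
    ; cap        = S.cap l
    ; factor⇒sweep-zero  = S.factor⇒sweep-zero
    ; factor⇒sweep-suc   = S.factor⇒sweep-suc
    ; sweep⇒factor⊎plain = S.sweep⇒factor⊎plain
    ; plain⇒large        = S.plain⇒subword l
    }
    where module S = Sweep _≟_ u⁺

  -- The threshold is shifted by one because `subword l` looks for `u ^ʷ suc l`.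
  target-sweepBlock : ∀ l u⁺ → Block.target (sweepBlock l u⁺) ≐ [ u⁺ ]₁ (suc l)
  target-sweepBlock l u⁺ =
    ( (λ { (inj₁ f) → inj₁ f ; {x} (inj₂ s) → inj₂ (⊆-respʳ (S.scan-letters x) s) })
    , (λ { (inj₁ f) → inj₁ f ; {x} (inj₂ s) → inj₂ (⊆-respʳ (≡.sym (S.scan-letters x)) s) }))
    where module S = Sweep _≟_ u⁺

  -- `Target` ends with an additional factor `U`. The last target absorbs it, being closed under
  -- extension to the right.
  Target-blocks : ∀ l u⁺ us → Target (List.map (sweepBlock l) (u⁺ ∷ us)) ≐ [ u⁺ ∷ us ]⁺ (suc l)
  Target-blocks l u⁺ [] =
    ( (λ { (x , y , refl , t , _) → proj₁ (target-sweepBlock l u⁺) (Block.target-++ˡ (sweepBlock l u⁺) x y t) })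
    , (λ {w} t → w , [] , ≡.sym (List.++-identityʳ w) , proj₂ (target-sweepBlock l u⁺) t , tt))
  Target-blocks l u⁺ (v⁺ ∷ us) =
    ( (λ { (x , y , eq , t , ts) → x , y , eq , proj₁ (target-sweepBlock l u⁺) t , proj₁ (Target-blocks l v⁺ us) ts })
    , (λ { (x , y , eq , t , ts) → x , y , eq , proj₂ (target-sweepBlock l u⁺) t , proj₂ (Target-blocks l v⁺ us) ts }))

  InPJ-generator : ∀ {L : Language A} → Generator L → InPJ L
  InPJ-generator (endsWith u)                 = Window.Suffix.InPJ-endsWith _≟_ u
  InPJ-generator (startsWith u)               = Window.Prefix.InPJ-startsWith _≟_ (List⁺.toList u)
  InPJ-generator (block (u ∷ us) (suc l) _) = InPJ-resp-≐ (Target bs) ([ u ∷ us ]⁺ (suc l))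
    (Target-blocks l u us) (InPJ-Target bs)
    where bs = List.map (sweepBlock l) (u ∷ us)

  InPJ-BooleanCombination : ∀ {L : Language A} → BooleanCombination Generator L → InPJ L
  InPJ-BooleanCombination (generator g)              = InPJ-generator g
  InPJ-BooleanCombination none                       = InPJ-constant ⊥
  InPJ-BooleanCombination (complement {L} c)         = InPJ-∁ L (InPJ-BooleanCombination c)
  InPJ-BooleanCombination (union {K} {L} c d)        =
    InPJ-∪ K L (InPJ-BooleanCombination c) (InPJ-BooleanCombination d)
  InPJ-BooleanCombination (intersection {K} {L} c d) =
    InPJ-∩ K L (InPJ-BooleanCombination c) (InPJ-BooleanCombination d)
  InPJ-BooleanCombination (same {K} {L} K≐L c)       = InPJ-resp-≐ K L K≐L (InPJ-BooleanCombination c)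

theorem4p6 : {A : Set} → Finite A → (L : Language A) → ThresholdDotDepthOne L → InPJ L
theorem4p6 (_ , A↔Fin) L c =
  InPJ-BooleanCombination (via-injection (Inverse⇒Injection (Symmetry.inverse A↔Fin)) Fin._≟_) c
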